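{- Let $n\ge1$, $b\ge1$. Let $\mu_1,\mu_2,\dots$ be i.i.d. random elements of $B_n$ with law $Q^B_{2b+1}$, and set $\tau_0=\mathrm{id}$, $\tau_r=\tau_{r-1}\circ\mu_r$ (the result of $r$ successive $(2b+1)$-shuffles). Then $(d(\tau_r^{ -1}))_{r\ge0}$ is a Markov chain on $\{0,\dots,n\}$ with stationary distribution $\pi(j)=\overline{A(n,j)}/(2^nn!)$, and its transition matrix $K$ satisfies $K(i,j)=\pi(j)P(j,i)/\pi(i)$, where $P$ is the transition matrix of the type $B$ base-$(2b+1)$ carries chain; i.e. its formal time reversal with respect to $\pi$ is the type $B$ carries chain.
   Context: $B_n$ is the group of signed permutations (bijections $\sigma$ of $\{\pm1,\dots,\pm n\}$ with $\sigma(-i)=-\sigma(i)$), composed as functions. With the order $1<2<\dots<n<-n<\dots<-1$, $\sigma$ has a descent at $i$ ($1\le i\le n-1$) if $\sigma(i)>\sigma(i+1)$ and at $n$ if $\sigma(n)<0$; $d(\sigma)$ is the number of descents and $\overline{A(n,j)}$ the number of $\sigma\in B_n$ with $j$ descents. Binomial convention: $\binom{m}{n}=0$ if $m<n$. The type $B$ $(2b+1)$-shuffle measure (cut multinomially into $2b+1$ piles, flip the even-numbered piles, riffle) is $Q^B_{2b+1}(\tau)=\binom{n+b-d(\tau^{ -1})}{n}/(2b+1)^n$; a $(2a+1)$-shuffle followed by a $(2b+1)$-shuffle has law $Q^B_{(2a+1)(2b+1)}$. The type $B$ base-$(2b+1)$ carries chain is the Markov chain on $\{0,\dots,n\}$ with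 $\kappa_0=0$, $\kappa_{t+1}=\lfloor(\kappa_t+b+X_{t+1,1}+\dots+X_{t+1,n})/(2b+1)\rfloor$, $X_{t,k}$ i.i.d. uniform on $\{0,\dots,2b\}$. -}

module Defs where

open import Data.Bool.Base using (if_then_else_; true; false)
open import Data.Empty using (⊥-elim)
open import Data.Fin.Base using (Fin; zero; suc; toℕ; fromℕ<; opposite)
import Data.Fin.Properties as Fin
open import Data.Integer.Base using (+_)
open import Data.List.Base as List
  using (List; []; _∷_; allFin; cartesianProduct; cartesianProductWith; filter; length; mapMaybe)
open import Data.List.Membership.Propositional using (_∈_)
open import Data.List.Membership.Propositional.Properties
  using (∈-allFin; ∈-cartesianProduct⁺; ∈-cartesianProductWith⁺)
open import Data.List.Relation.Unary.All using (All; []; _∷_)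
open import Data.List.Relation.Unary.AllPairs using (AllPairs; []; _∷_)
open import Data.List.Relation.Unary.Any using (Any; here; there)
open import Data.List.Relation.Unary.Unique.Propositional using (Unique)
open import Data.List.Relation.Unary.Unique.Propositional.Properties
  using (allFin⁺; cartesianProduct⁺; cartesianProductWith⁺)
open import Data.Maybe.Base using (Maybe; just; nothing)
open import Data.Nat.Base as ℕ using (ℕ; zero; suc; z≤n; s≤s; _!)
open import Data.Nat.Combinatorics using (_C_)
open import Data.Nat.DivMod using (m<n*o⇒m/o<n)
import Data.Nat.Properties as ℕ
open import Data.Nat.Solver using (module +-*-Solver)
open import Data.Product.Base using (Σ; _×_; _,_; proj₁; proj₂)
import Data.Product.Properties as Product
open import Data.Rational.Base as ℚ using (ℚ; 0ℚ; 1ℚ; NonZero)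
open import Data.Sign.Base as Sign using (Sign)
import Data.Sign.Properties as Sign
open import Data.Vec.Base as Vec using (Vec; []; _∷_; lookup; tabulate)
import Data.Vec.Properties as Vec
open import Function.Base using (_∘_)
open import Function.Bundles using (_↔_; mk↔ₛ′; module Inverse)
open import Function.Construct.Composition using (_↔-∘_)
open import Function.Construct.Identity using (↔-id)
open import Function.Construct.Symmetry using (↔-sym)
open import Level using (0ℓ)
open import Relation.Binary.PropositionalEquality
open import Relation.Nullary using (Dec; yes; no; does; ¬_; _×-dec_)
open import Relation.Unary using (Pred; Decidable)
open import Relation.Unary.Properties using (_∩?_)

-- (+ , i) is the letter i + 1 and (- , i) is the letter -(i + 1).
Letter : ℕ → Set
Letter n = Sign × Fin n

neg : ∀ {n} → Letter n → Letter n
neg (s , i) = Sign.opposite s , i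

pos : ∀ {n} → Fin n → Letter n
pos i = Sign.+ , i

record SignedPerm (n : ℕ) : Set where
  constructor signedPerm
  field
    bijection : Letter n ↔ Letter n
  open Inverse bijection public using (to; from; strictlyInverseˡ; strictlyInverseʳ)
  field
    odd : ∀ x → to (neg x) ≡ neg (to x)

open SignedPerm public using (to; from)

infix 4 _≈_
_≈_ : ∀ {n} → SignedPerm n → SignedPerm n → Set
σ ≈ τ = ∀ x → to σ x ≡ to τ x

idₛ : ∀ {n} → SignedPerm n
idₛ = signedPerm (↔-id _) (λ _ → refl)

-- to (σ ∘ₛ τ) x = to σ (to τ x)
infixr 9 _∘ₛ_
_∘ₛ_ : ∀ {n} → SignedPerm n → SignedPerm n → SignedPerm n
σ ∘ₛ τ = signedPerm (SignedPerm.bijection σ ↔-∘ SignedPerm.bijection τ)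
  (λ x → trans (cong (to σ) (SignedPerm.odd τ x)) (SignedPerm.odd σ (to τ x)))

infix 10 _⁻¹
_⁻¹ : ∀ {n} → SignedPerm n → SignedPerm n
σ ⁻¹ = signedPerm (↔-sym (SignedPerm.bijection σ)) odd⁻¹
  where
  odd⁻¹ : ∀ x → from σ (neg x) ≡ neg (from σ x)
  odd⁻¹ x = begin
    from σ (neg x)                    ≡⟨ cong (from σ ∘ neg) (SignedPerm.strictlyInverseˡ σ x) ⟨
    from σ (neg (to σ (from σ x)))    ≡⟨ cong (from σ) (SignedPerm.odd σ (from σ x)) ⟨
    from σ (to σ (neg (from σ x)))    ≡⟨ SignedPerm.strictlyInverseʳ σ (neg (from σ x)) ⟩
    neg (from σ x)                    ∎
    where open ≡-Reasoning

word : ∀ {n} → SignedPerm n → Vec (Letter n) n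
word σ = tabulate (to σ ∘ pos)

allVecs : ∀ {A : Set} → List A → ∀ k → List (Vec A k)
allVecs xs zero    = [] ∷ []
allVecs xs (suc k) = cartesianProductWith _∷_ xs (allVecs xs k)

allLetters : ∀ n → List (Letter n)
allLetters n = cartesianProduct (Sign.+ ∷ Sign.- ∷ []) (allFin n)

act : ∀ {n} → Vec (Letter n) n → Letter n → Letter n
act w (s , i) = s Sign.* proj₁ (lookup w i) , proj₂ (lookup w i)

MutuallyInverse : ∀ {n} → Vec (Letter n) n × Vec (Letter n) n → Set
MutuallyInverse (v , w) =
  (∀ i → act v (lookup w i) ≡ pos i) × (∀ i → act w (lookup v i) ≡ pos i)

infix 4 _≟ᴸ_
_≟ᴸ_ : ∀ {n} (x y : Letter n) → Dec (x ≡ y)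
_≟ᴸ_ = Product.≡-dec Sign._≟_ Fin._≟_

mutuallyInverse? : ∀ {n} → Decidable (MutuallyInverse {n})
mutuallyInverse? (v , w) =
  Fin.all? (λ i → act v (lookup w i) ≟ᴸ pos i) ×-dec Fin.all? (λ i → act w (lookup v i) ≟ᴸ pos i)

act-odd : ∀ {n} (w : Vec (Letter n) n) x → act w (neg x) ≡ neg (act w x)
act-odd w (Sign.+ , i) = refl
act-odd w (Sign.- , i) = cong (_, proj₂ (lookup w i)) (sym (Sign.opposite-involutive _))

act-inverse : ∀ {n} (v w : Vec (Letter n) n) →
  (∀ i → act v (lookup w i) ≡ pos i) → ∀ x → act v (act w x) ≡ x
act-inverse v w inv (Sign.+ , i) = inv i
act-inverse v w inv (Sign.- , i) = trans (act-odd v (lookup w i)) (cong neg (inv i))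

fromWords : ∀ {n} → Vec (Letter n) n × Vec (Letter n) n → Maybe (SignedPerm n)
fromWords (v , w) with mutuallyInverse? (v , w)
... | yes (vw , wv) =
  just (signedPerm (mk↔ₛ′ (act v) (act w) (act-inverse v w vw) (act-inverse w v wv)) (act-odd v))
... | no _ = nothing

-- Every signed permutation is listed exactly once up to _≈_, as shown by
-- allSignedPerms-complete and allSignedPerms-unique.
allSignedPerms : ∀ n → List (SignedPerm n)
allSignedPerms n = mapMaybe fromWords (cartesianProduct words words)
  where words = allVecs (allLetters n) n

allVecs-complete : ∀ {A : Set} {xs : List A} → (∀ x → x ∈ xs) → ∀ {k} (v : Vec A k) → v ∈ allVecs xs k
allVecs-complete all∈ []      = here refl
allVecs-complete all∈ (x ∷ v) = ∈-cartesianProductWith⁺ _∷_ (all∈ x) (allVecs-complete all∈ v)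

allVecs-unique : ∀ {A : Set} {xs : List A} → Unique xs → ∀ k → Unique (allVecs xs k)
allVecs-unique u zero    = [] ∷ []
allVecs-unique u (suc k) = cartesianProductWith⁺ _∷_ Vec.∷-injective u (allVecs-unique u k)

∈-allLetters : ∀ {n} (x : Letter n) → x ∈ allLetters n
∈-allLetters (s , i) = ∈-cartesianProduct⁺ (∈-signs s) (∈-allFin i)
  where
  ∈-signs : ∀ s → s ∈ (Sign.+ ∷ Sign.- ∷ [])
  ∈-signs Sign.+ = here refl
  ∈-signs Sign.- = there (here refl)

allLetters-unique : ∀ n → Unique (allLetters n)
allLetters-unique n = cartesianProduct⁺ (((λ ()) ∷ []) ∷ ([] ∷ [])) (allFin⁺ n)

act-word : ∀ {n} (σ : SignedPerm n) x → act (word σ) x ≡ to σ x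
act-word σ (Sign.+ , i) = Vec.lookup∘tabulate (to σ ∘ pos) i
act-word σ (Sign.- , i) =
  trans (cong neg (Vec.lookup∘tabulate (to σ ∘ pos) i)) (sym (SignedPerm.odd σ (pos i)))

private
  Lists : ∀ {n} → SignedPerm n → Maybe (SignedPerm n) → Set
  Lists σ m = Σ _ λ τ → m ≡ just τ × σ ≈ τ

  fromWords-word : ∀ {n} (σ : SignedPerm n) → Lists σ (fromWords (word σ , word (σ ⁻¹)))
  fromWords-word σ with mutuallyInverse? (word σ , word (σ ⁻¹))
  ... | yes _ = _ , refl , λ x → sym (act-word σ x)
  ... | no ¬i = ⊥-elim (¬i (inverse σ (σ ⁻¹) (SignedPerm.strictlyInverseˡ σ)
                          , inverse (σ ⁻¹) σ (SignedPerm.strictlyInverseʳ σ)))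
    where
    inverse : ∀ {n} (σ τ : SignedPerm n) → (∀ x → to σ (to τ x) ≡ x) →
      ∀ i → act (word σ) (lookup (word τ) i) ≡ pos i
    inverse σ τ h i = trans (act-word σ _)
      (trans (cong (to σ) (Vec.lookup∘tabulate (to τ ∘ pos) i)) (h (pos i)))

  fromWords-injective : ∀ {n} (p q : Vec (Letter n) n × Vec (Letter n) n) {σ τ} →
    fromWords p ≡ just σ → fromWords q ≡ just τ → σ ≈ τ → p ≡ q
  fromWords-injective (v , w) (v′ , w′) e e′ σ≈τ
    with mutuallyInverse? (v , w) | mutuallyInverse? (v′ , w′)
  fromWords-injective (v , w) (v′ , w′) refl refl σ≈τ | yes (vw , wv) | yes (vw′ , wv′) =
    cong₂ _,_ (ext (σ≈τ ∘ pos)) (ext λ i → begin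
      lookup w i                              ≡⟨ act-inverse w′ v′ wv′ (lookup w i) ⟨
      act w′ (act v′ (lookup w i))            ≡⟨ cong (act w′) (σ≈τ (lookup w i)) ⟨
      act w′ (act v (lookup w i))             ≡⟨ cong (act w′) (vw i) ⟩
      lookup w′ i                             ∎)
    where
    open ≡-Reasoning
    ext : ∀ {A : Set} {k} {xs ys : Vec A k} → (∀ i → lookup xs i ≡ lookup ys i) → xs ≡ ys
    ext {xs = xs} {ys} h =
      trans (sym (Vec.tabulate∘lookup xs)) (trans (Vec.tabulate-cong h) (Vec.tabulate∘lookup ys))

  module _ {A B : Set} (f : A → Maybe B) {_~_ : B → B → Set} where

    mapMaybe-any : ∀ {P : Pred B 0ℓ} {x xs} → x ∈ xs → (Σ B λ y → f x ≡ just y × P y) →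
      Any P (mapMaybe f xs)
    mapMaybe-any {xs = x ∷ _} (here refl) (y , e , py) with f x
    mapMaybe-any {xs = x ∷ _} (here refl) (y , refl , py) | just _ = here py
    mapMaybe-any {xs = x ∷ _} (there x∈) h with f x
    ... | just _  = there (mapMaybe-any x∈ h)
    ... | nothing = mapMaybe-any x∈ h

    mapMaybe-all : (∀ {x y a b} → f x ≡ just a → f y ≡ just b → a ~ b → x ≡ y) →
      ∀ {x a} → f x ≡ just a → ∀ {xs} → All (x ≢_) xs → All (λ b → ¬ a ~ b) (mapMaybe f xs)
    mapMaybe-all inj fx [] = []
    mapMaybe-all inj fx {y ∷ _} (x≢y ∷ x∉) with f y in fy
    ... | just _  = (λ a~b → x≢y (inj fx fy a~b)) ∷ mapMaybe-all inj fx x∉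
    ... | nothing = mapMaybe-all inj fx x∉

    mapMaybe-unique : (∀ {x y a b} → f x ≡ just a → f y ≡ just b → a ~ b → x ≡ y) →
      ∀ {xs} → Unique xs → AllPairs (λ a b → ¬ a ~ b) (mapMaybe f xs)
    mapMaybe-unique inj [] = []
    mapMaybe-unique inj {x ∷ _} (x∉ ∷ u) with f x in fx
    ... | just _  = mapMaybe-all inj fx x∉ ∷ mapMaybe-unique inj u
    ... | nothing = mapMaybe-unique inj u

allSignedPerms-complete : ∀ {n} (σ : SignedPerm n) → Any (σ ≈_) (allSignedPerms n)
allSignedPerms-complete σ =
  mapMaybe-any fromWords {_≈_} (∈-cartesianProduct⁺ (∈-words (word σ)) (∈-words (word (σ ⁻¹))))
    (fromWords-word σ)
  where ∈-words = allVecs-complete ∈-allLetters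

allSignedPerms-unique : ∀ n → AllPairs (λ σ τ → ¬ σ ≈ τ) (allSignedPerms n)
allSignedPerms-unique n =
  mapMaybe-unique fromWords (λ {p} {q} → fromWords-injective p q) (cartesianProduct⁺ words! words!)
  where words! = allVecs-unique (allLetters-unique n) n

-- Position of a letter in the order 1 < 2 < … < n < -n < … < -1.
rank : ∀ {n} → Letter n → ℕ
rank     (Sign.+ , i) = toℕ i
rank {n} (Sign.- , i) = n ℕ.+ toℕ (opposite i)

infix 4 _≻?_
_≻?_ : ∀ {n} (x y : Letter n) → Dec (rank y ℕ.< rank x)
x ≻? y = rank y ℕ.<? rank x

-- The descent at position n: the last letter is negative.
finalDescent : ∀ {n} → Letter n → ℕ
finalDescent (Sign.+ , _) = 0
finalDescent (Sign.- , _) = 1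

descents : ∀ {n k} → Vec (Letter n) k → ℕ
descents []              = 0
descents (x ∷ [])        = finalDescent x
descents (x ∷ w@(y ∷ _)) = (if does (x ≻? y) then 1 else 0) ℕ.+ descents w

descents≤ : ∀ {n k} (w : Vec (Letter n) k) → descents w ℕ.≤ k
descents≤ []                  = z≤n
descents≤ ((Sign.+ , _) ∷ []) = z≤n
descents≤ ((Sign.- , _) ∷ []) = s≤s z≤n
descents≤ (x ∷ w@(y ∷ _))     = ℕ.+-mono-≤ (indicator≤1 (does (x ≻? y))) (descents≤ w)
  where
  indicator≤1 : ∀ c → (if c then 1 else 0) ℕ.≤ 1
  indicator≤1 false = z≤n
  indicator≤1 true  = s≤s z≤n

State : ℕ → Set
State n = Fin (suc n)

d : ∀ {n} → SignedPerm n → State n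
d σ = fromℕ< (s≤s (descents≤ (word σ)))

eulerianᴮ : ∀ n → State n → ℕ
eulerianᴮ n j = length (filter (λ σ → d σ Fin.≟ j) (allSignedPerms n))

sumOver : ∀ {A : Set} → List A → (A → ℚ) → ℚ
sumOver xs f = List.foldr (λ x s → f x ℚ.+ s) 0ℚ xs

record FinSpace : Set₁ where
  field
    Ω        : Set
    outcomes : List Ω
    mass     : Ω → ℚ

open FinSpace public

Pr : (𝒫 : FinSpace) {E : Pred (Ω 𝒫) 0ℓ} → Decidable E → ℚ
Pr 𝒫 E? = sumOver (filter E? (outcomes 𝒫)) (mass 𝒫)

condPr : (𝒫 : FinSpace) {E F : Pred (Ω 𝒫) 0ℓ} (E? : Decidable E) (F? : Decidable F) →
  .{{_ : NonZero (Pr 𝒫 F?)}} → ℚ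
condPr 𝒫 E? F? = Pr 𝒫 (E? ∩? F?) ℚ.÷ Pr 𝒫 F?

-- r independent samples of 𝒫, under the product measure.
iid : FinSpace → ℕ → FinSpace
iid 𝒫 r = record
  { Ω        = Vec (Ω 𝒫) r
  ; outcomes = allVecs (outcomes 𝒫) r
  ; mass     = Vec.foldr′ (λ ω p → mass 𝒫 ω ℚ.* p) 1ℚ
  }

Matrix : ℕ → Set
Matrix k = Fin k → Fin k → ℚ

record IsStochastic {k} (K : Matrix k) : Set where
  field
    nonNegative : ∀ i j → 0ℚ ℚ.≤ K i j
    rowSum      : ∀ i → sumOver (allFin k) (K i) ≡ 1ℚ

record IsStationary {k} (π : Fin k → ℚ) (K : Matrix k) : Set where
  field
    nonNegative : ∀ i → 0ℚ ℚ.≤ π i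
    total       : sumOver (allFin k) π ≡ 1ℚ
    invariant   : ∀ j → sumOver (allFin k) (λ i → π i ℚ.* K i j) ≡ π j

-- X ω is the value at time r of a process, as a function of the first r
-- terms ω of an input sequence; path X ω lists its values at times 0,…,r.
path : ∀ {A S : Set} (X : ∀ {r} → Vec A r → S) {r} → Vec A r → Vec S (suc r)
path X []       = X [] ∷ []
path X (ω ∷ ωs) = X [] ∷ path (λ v → X (ω ∷ v)) ωs

-- The process X driven by i.i.d. samples of 𝒫 is a (time-homogeneous) Markov
-- chain with transition matrix K: conditionally on any history js of positive
-- probability up to time r, the law at time r + 1 is the row K (last js).
record IsMarkovChain (𝒫 : FinSpace) {k} (X : ∀ {r} → Vec (Ω 𝒫) r → Fin k) (K : Matrix k) : Set where
  field
    stochastic : IsStochastic K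
    transition : ∀ {r} (js : Vec (Fin k) (suc r)) (j : Fin k) →
      let future? = λ ω → X ω Fin.≟ j
          past?   = λ ω → Vec.≡-dec Fin._≟_ (Vec.init (path X ω)) js
      in (pos : NonZero (Pr (iid 𝒫 (suc r)) past?)) →
         condPr (iid 𝒫 (suc r)) future? past? {{pos}} ≡ K (Vec.last js) j

timeReversal : ∀ {k} (π : Fin k → ℚ) → (∀ i → NonZero (π i)) → Matrix k → Matrix k
timeReversal π π≢0 K i j = ((π j ℚ.* K j i) ℚ.÷ π i) {{π≢0 i}}

-- Truncated subtraction is harmless: toℕ (d (τ ⁻¹)) ≤ n.
Q : ∀ {n} → ℕ → SignedPerm n → ℚ
Q {n} b τ = (+ ((n ℕ.+ b ℕ.∸ toℕ (d (τ ⁻¹))) C n) ℚ./ (suc (2 ℕ.* b) ℕ.^ n))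
  {{ℕ.m^n≢0 (suc (2 ℕ.* b)) n}}

shuffle : ℕ → ℕ → FinSpace
shuffle n b = record { Ω = SignedPerm n ; outcomes = allSignedPerms n ; mass = Q b }

-- τ_r = (…((id ∘ μ₁) ∘ μ₂) ∘ …) ∘ μ_r
shuffled : ∀ {n r} → Vec (SignedPerm n) r → SignedPerm n
shuffled = Vec.foldl′ _∘ₛ_ idₛ

descentProcess : ∀ {n r} → Vec (SignedPerm n) r → State n
descentProcess μs = d (shuffled μs ⁻¹)

π : ∀ n → State n → ℚ
π n j = (+ eulerianᴮ n j ℚ./ (2 ℕ.^ n ℕ.* n !)) {{ℕ.m*n≢0 _ _ {{ℕ.m^n≢0 2 n}} {{n ℕ.!≢0}}}}

Digit : ℕ → Set
Digit b = Fin (suc (2 ℕ.* b))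

uniformDigit : ℕ → FinSpace
uniformDigit b = record
  { Ω = Digit b ; outcomes = allFin _ ; mass = λ _ → + 1 ℚ./ suc (2 ℕ.* b) }

digitSum : ∀ {m k} → Vec (Fin m) k → ℕ
digitSum xs = Vec.sum (Vec.map toℕ xs)

digitSum≤ : ∀ {m k} (xs : Vec (Fin (suc m)) k) → digitSum xs ℕ.≤ k ℕ.* m
digitSum≤ []       = z≤n
digitSum≤ (x ∷ xs) = ℕ.+-mono-≤ (Fin.toℕ≤pred[n] x) (digitSum≤ xs)

newCarry : ∀ {n} b → State n → Vec (Digit b) n → ℕ
newCarry b κ xs = (toℕ κ ℕ.+ b ℕ.+ digitSum xs) ℕ./ suc (2 ℕ.* b)

newCarry< : ∀ {n} b (κ : State n) (xs : Vec (Digit b) n) → newCarry b κ xs ℕ.< suc n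
newCarry< {n} b κ xs = m<n*o⇒m/o<n (begin-strict
  toℕ κ ℕ.+ b ℕ.+ digitSum xs              ≤⟨ ℕ.+-mono-≤ (ℕ.+-monoˡ-≤ b (Fin.toℕ≤pred[n] κ)) (digitSum≤ xs) ⟩
  n ℕ.+ b ℕ.+ n ℕ.* (2 ℕ.* b)              <⟨ s≤s (ℕ.m≤m+n _ b) ⟩
  suc (n ℕ.+ b ℕ.+ n ℕ.* (2 ℕ.* b) ℕ.+ b)  ≡⟨ solve 2 (λ n b →
      con 1 :+ (n :+ b :+ n :* (con 2 :* b) :+ b) := (con 1 :+ n) :* (con 1 :+ con 2 :* b)) refl n b ⟩
  suc n ℕ.* suc (2 ℕ.* b)                  ∎)
  where
  open ℕ.≤-Reasoning
  open +-*-Solver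

carryStep : ∀ {n} b → State n → Vec (Digit b) n → State n
carryStep b κ xs = fromℕ< (newCarry< b κ xs)

-- P n b i j is the probability that the carry i is followed by the carry j
-- when the n digits are i.i.d. uniform on {0,…,2b}.
P : ∀ n → ℕ → Matrix (suc n)
P n b i j = Pr (iid (uniformDigit b) n) (λ xs → carryStep b i xs Fin.≟ j)

module Submission where

-- Give every letter a digit in {0,…,N-1}, N = 2b+1, with opposite letters getting
-- complementary digits, and let γ h be the signed permutation sorting the letters by digit,
-- ties broken by the order of the letters; then γ h ∘ ρ has a descent exactly where the
-- digits h ∘ ρ (with ties decided by the descents of ρ) drop. Replacing consecutive digits
-- by their differences modulo N, each drop becomes a wrap-around, so the number of descents
-- of γ h ∘ ρ is distributed as ⌊(d ρ + b + X₁ + … + Xₙ) / N⌋: one carries step from d ρ.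
-- Since only the identity has no descents, the case of no carry counts the h with
-- γ h = ρ⁻¹ and identifies the law of γ h with the inverse shuffle. Hence, for fixed τ′,
-- the sum of Q(τ⁻¹τ′) over the class d(τ⁻¹) = i is P(d(τ′⁻¹), i), which depends only on
-- d(τ′⁻¹). So, started from the class {id}, the shuffle stays uniform on the classes given
-- any history of descent numbers, and those form a Markov chain with transition matrix
-- |class j| P(j, i) / |class i|.

open import Algebra.Core using (Op₂)
open import Algebra.Structures using (IsCommutativeRing; IsCommutativeSemiring)
open import Data.Bool.Base using (if_then_else_; true; false)
open import Data.Empty using (⊥-elim)
open import Data.Fin.Base as Fin using (Fin; zero; suc; toℕ; fromℕ; fromℕ<; opposite; punchOut)
import Data.Fin.Properties as Fin
import Data.Integer.Base as ℤ
import Data.Integer.Properties as ℤ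
open import Data.List.Base as List
  using (List; []; _∷_; _++_; allFin; cartesianProductWith; filter; length)
import Data.List.Properties as List
open import Data.List.Membership.Propositional using (_∈_)
open import Data.List.Membership.Propositional.Properties using (∈-allFin)
open import Data.List.Relation.Unary.All as All using (All; []; _∷_)
open import Data.List.Relation.Unary.AllPairs using (AllPairs; []; _∷_)
open import Data.List.Relation.Unary.Any using (Any; here; there)
open import Data.List.Relation.Unary.Unique.Propositional using (Unique)
open import Data.List.Relation.Unary.Unique.Propositional.Properties using (allFin⁺)
open import Data.Nat.Base as ℕ
  using (ℕ; zero; suc; z≤n; s≤s; _+_; _*_; _∸_; _^_; _!; _/_; _≤_; _<_)
open import Data.Nat.Combinatorics
  using (_C_; nCn≡1; nCk≡nC[n∸k]; k>n⇒nCk≡0; nCk+nC[k+1]≡[n+1]C[k+1])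
open import Data.Nat.Divisibility using (n∣m*n)
open import Data.Nat.DivMod
  using (m<n⇒m/n≡0; m/n≡1+[m∸n]/n; +-distrib-/-∣ˡ; m*n/n≡m; m/n≡0⇒m<n)
import Data.Nat.Properties as ℕ
open import Data.Nat.Solver using (module +-*-Solver)
open import Data.Product.Base using (Σ-syntax; ∃; _×_; _,_; proj₁; proj₂)
open import Data.Rational.Base as ℚ using (ℚ; 0ℚ; 1ℚ; NonZero; Positive; fromℚᵘ)
import Data.Rational.Properties as ℚ
open import Data.Rational.Unnormalised.Base as ℚᵘ using (mkℚᵘ; *≡*)
import Data.Rational.Unnormalised.Properties as ℚᵘ
open import Data.Sign.Base as Sign using (Sign)
import Data.Sign.Properties as Sign
open import Data.Sum.Base using (_⊎_; inj₁; inj₂)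
open import Data.Vec.Base as Vec using (Vec; []; _∷_; lookup; tabulate)
import Data.Vec.Properties as Vec
import Data.Vec.Relation.Unary.All as Allᵛ
open import Data.Vec.Relation.Unary.AllPairs using ([]; _∷_; allPairs?)
open import Data.Vec.Relation.Unary.Unique.Propositional renaming (Unique to Uniqueᵛ)
import Data.Vec.Relation.Unary.Unique.Propositional.Properties as Uniqueᵛ
open import Function.Base using (_∘_; id)
open import Function.Bundles using (mk↔ₛ′)
open import Level using (0ℓ)
open import Relation.Binary.Definitions using (DecidableEquality; tri<; tri≈; tri>)
open import Relation.Binary.PropositionalEquality
open import Relation.Binary.Structures using (IsEquivalence)
open import Relation.Nullary using (Dec; yes; no; does; ¬_; ¬?; _×-dec_; contradiction)
open import Relation.Nullary.Decidable using (map′)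
open import Relation.Unary using (Pred; Decidable)
open import Relation.Unary.Properties using (_∩?_)
open import Defs


-- The class sum of `Q` runs over the sources `τ` of a step with the target `τ′` fixed, whereas the
-- usual lumping criterion asks for sums over targets from a fixed source. The chain is therefore
-- not lumped from each starting permutation separately: histories are summed over all starting
-- points at once, and the start at the identity is recovered because it is alone in its class.
--
-- Complementary digits on opposite letters serve two ends. They make sorting commute with negation,
-- so that its result is a signed permutation. They also turn the final descent into a comparison of
-- the last letter with its opposite, of digits `a` and `2b - a`; the resulting threshold `b` is the
-- offset in the type B carry.
--
-- A signed permutation is a record of functions with proofs, so equality in the group is `_≈_`, and
-- sums over the group are handled through enumerations up to an equivalence.

record Enumeration (A : Set) : Set₁ where
  field
    elements      : List A
    _~_           : A → A → Set
    ~-isEquivalence : IsEquivalence _~_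
    _~?_          : ∀ x y → Dec (x ~ y)
    complete      : ∀ x → Any (x ~_) elements
    unique        : AllPairs (λ x y → ¬ x ~ y) elements
  open IsEquivalence ~-isEquivalence public
    using () renaming (refl to ~-refl; sym to ~-sym; trans to ~-trans)

  -- The condition under which a sum over `elements` does not depend on the representatives listed.
  Respects : {B : Set} → (A → B) → Set
  Respects f = ∀ {x y} → x ~ y → f x ≡ f y

open Enumeration

fins : ∀ k → Enumeration (Fin k)
fins k = record
  { elements = allFin k ; ~-isEquivalence = isEquivalence ; _~?_ = Fin._≟_
  ; complete = ∈-allFin ; unique = allFin⁺ k }

vecs : ∀ {A : Set} → DecidableEquality A → {xs : List A} → (∀ x → x ∈ xs) → Unique xs →
  ∀ k → Enumeration (Vec A k)
vecs _≟_ {xs} all∈ xs! k = record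
  { elements = allVecs xs k ; ~-isEquivalence = isEquivalence ; _~?_ = Vec.≡-dec _≟_
  ; complete = allVecs-complete all∈ ; unique = allVecs-unique xs! k }

-- Finite sums and indicators in a commutative semiring

module Summation {R : Set} {_+_ _*_ : Op₂ R} {0# 1# : R}
  (isCommutativeSemiring : IsCommutativeSemiring _≡_ _+_ _*_ 0# 1#) where

  open IsCommutativeSemiring isCommutativeSemiring
    using ( +-assoc; +-comm; +-identityˡ; +-identityʳ; *-assoc; *-comm; *-identityˡ; *-identityʳ
          ; distribˡ; distribʳ; zeroˡ; zeroʳ)
  open ≡-Reasoning

  private variable
    A B C : Set
    X Y : Set

  ∑ : List A → (A → R) → R
  ∑ xs f = List.foldr (λ x s → f x + s) 0# xs

  ∑-cong : ∀ (xs : List A) {f g : A → R} → (∀ x → f x ≡ g x) → ∑ xs f ≡ ∑ xs g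
  ∑-cong []       f≡g = refl
  ∑-cong (x ∷ xs) f≡g = cong₂ _+_ (f≡g x) (∑-cong xs f≡g)

  ∑-zero : ∀ (xs : List A) {f : A → R} → All (λ x → f x ≡ 0#) xs → ∑ xs f ≡ 0#
  ∑-zero []       []           = refl
  ∑-zero (x ∷ xs) (fx≡0 ∷ f≡0) = trans (cong₂ _+_ fx≡0 (∑-zero xs f≡0)) (+-identityˡ 0#)

  +-interchange : ∀ a b c d → (a + b) + (c + d) ≡ (a + c) + (b + d)
  +-interchange a b c d = begin
    (a + b) + (c + d)  ≡⟨ +-assoc a b (c + d) ⟩
    a + (b + (c + d))  ≡⟨ cong (a +_) (+-assoc b c d) ⟨
    a + ((b + c) + d)  ≡⟨ cong (λ z → a + (z + d)) (+-comm b c) ⟩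
    a + ((c + b) + d)  ≡⟨ cong (a +_) (+-assoc c b d) ⟩
    a + (c + (b + d))  ≡⟨ +-assoc a c (b + d) ⟨
    (a + c) + (b + d)  ∎

  ∑-+ : ∀ (xs : List A) (f g : A → R) → ∑ xs (λ x → f x + g x) ≡ ∑ xs f + ∑ xs g
  ∑-+ []       f g = sym (+-identityˡ 0#)
  ∑-+ (x ∷ xs) f g = trans (cong ((f x + g x) +_) (∑-+ xs f g)) (+-interchange _ _ _ _)

  ∑-*ˡ : ∀ (xs : List A) c (f : A → R) → ∑ xs (λ x → c * f x) ≡ c * ∑ xs f
  ∑-*ˡ []       c f = sym (zeroʳ c)
  ∑-*ˡ (x ∷ xs) c f = trans (cong ((c * f x) +_) (∑-*ˡ xs c f)) (sym (distribˡ c _ _))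

  ∑-*ʳ : ∀ (xs : List A) c (f : A → R) → ∑ xs (λ x → f x * c) ≡ ∑ xs f * c
  ∑-*ʳ xs c f = trans (∑-cong xs (λ x → *-comm (f x) c)) (trans (∑-*ˡ xs c f) (*-comm c _))

  ∑-swap : ∀ (xs : List A) (ys : List B) (f : A → B → R) →
    ∑ xs (λ x → ∑ ys (f x)) ≡ ∑ ys (λ y → ∑ xs (λ x → f x y))
  ∑-swap []       ys f = sym (∑-zero ys (All.universal (λ _ → refl) ys))
  ∑-swap (x ∷ xs) ys f = trans (cong (∑ ys (f x) +_) (∑-swap xs ys f)) (sym (∑-+ ys (f x) _))

  ∑-++ : ∀ (xs ys : List A) (f : A → R) → ∑ (xs ++ ys) f ≡ ∑ xs f + ∑ ys f
  ∑-++ []       ys f = sym (+-identityˡ _)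
  ∑-++ (x ∷ xs) ys f = trans (cong (f x +_) (∑-++ xs ys f)) (sym (+-assoc _ _ _))

  ∑-map : ∀ (g : A → B) (xs : List A) (f : B → R) → ∑ (List.map g xs) f ≡ ∑ xs (λ x → f (g x))
  ∑-map g []       f = refl
  ∑-map g (x ∷ xs) f = cong (f (g x) +_) (∑-map g xs f)

  ∑-cartesianProductWith : ∀ (g : A → B → C) (xs : List A) (ys : List B) (f : C → R) →
    ∑ (cartesianProductWith g xs ys) f ≡ ∑ xs (λ x → ∑ ys (λ y → f (g x y)))
  ∑-cartesianProductWith g []       ys f = refl
  ∑-cartesianProductWith g (x ∷ xs) ys f =
    trans (∑-++ (List.map (g x) ys) _ f)
      (cong₂ _+_ (∑-map (g x) ys f) (∑-cartesianProductWith g xs ys f))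

  -- Reads only `does`, so over the naturals it is definitionally the summand used in `descents`.
  ⟦_⟧ : Dec X → R
  ⟦ p ⟧ = if does p then 1# else 0#

  ⟦⟧-yes : (p : Dec X) → X → ⟦ p ⟧ ≡ 1#
  ⟦⟧-yes (yes _) _ = refl
  ⟦⟧-yes (no ¬x) x = contradiction x ¬x

  ⟦⟧-no : (p : Dec X) → ¬ X → ⟦ p ⟧ ≡ 0#
  ⟦⟧-no (yes x) ¬x = contradiction x ¬x
  ⟦⟧-no (no _)  _  = refl

  ⟦⟧-⇔ : (p : Dec X) (q : Dec Y) → (X → Y) → (Y → X) → ⟦ p ⟧ ≡ ⟦ q ⟧
  ⟦⟧-⇔ (yes x) q f g = sym (⟦⟧-yes q (f x))
  ⟦⟧-⇔ (no ¬x) q f g = sym (⟦⟧-no q (λ y → ¬x (g y)))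

  ⟦⟧-× : (p : Dec X) (q : Dec Y) → ⟦ p ×-dec q ⟧ ≡ ⟦ p ⟧ * ⟦ q ⟧
  ⟦⟧-× (yes _) q = sym (*-identityˡ _)
  ⟦⟧-× (no _)  q = sym (zeroˡ _)

  -- Lets an equation that depends on `X` be used inside a sum restricted to `X` by its indicator.
  ⟦⟧-guard : (p : Dec X) {r s : R} → (X → r ≡ s) → ⟦ p ⟧ * r ≡ ⟦ p ⟧ * s
  ⟦⟧-guard (yes x) r≡s = cong (1# *_) (r≡s x)
  ⟦⟧-guard (no _)  _   = trans (zeroˡ _) (sym (zeroˡ _))

  ∑-filter : ∀ {E : Pred A 0ℓ} (E? : Decidable E) xs (f : A → R) →
    ∑ (filter E? xs) f ≡ ∑ xs (λ x → ⟦ E? x ⟧ * f x)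
  ∑-filter E? []       f = refl
  ∑-filter E? (x ∷ xs) f with does (E? x)
  ... | true  = cong₂ _+_ (sym (*-identityˡ _)) (∑-filter E? xs f)
  ... | false = trans (∑-filter E? xs f) (sym (trans (cong₂ _+_ (zeroˡ (f x)) refl) (+-identityˡ _)))

  ∑-pick : ∀ (E : Enumeration A) {f : A → R} → Respects E f → ∀ x →
    ∑ (elements E) (λ y → ⟦ _~?_ E x y ⟧ * f y) ≡ f x
  ∑-pick E {f} f-resp x = go (complete E x) (unique E)
    where
    none : ∀ {ys} → All (λ y → ¬ _~_ E x y) ys → ∑ ys (λ y → ⟦ _~?_ E x y ⟧ * f y) ≡ 0#
    none {ys} ¬x~ = ∑-zero ys (All.map (λ {y} ¬p → trans (cong (_* f y) (⟦⟧-no (_~?_ E x y) ¬p)) (zeroˡ _)) ¬x~)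
    go : ∀ {ys} → Any (_~_ E x) ys → AllPairs (λ a b → ¬ _~_ E a b) ys →
      ∑ ys (λ y → ⟦ _~?_ E x y ⟧ * f y) ≡ f x
    go {y ∷ ys} (here x~y) (y≁ ∷ _) = begin
      (⟦ _~?_ E x y ⟧ * f y) + ∑ ys _  ≡⟨ cong₂ _+_ (cong (_* f y) (⟦⟧-yes (_~?_ E x y) x~y))
                                           (none (All.map (λ y≁z x~z → y≁z (~-trans E (~-sym E x~y) x~z)) y≁)) ⟩
      (1# * f y) + 0#                  ≡⟨ trans (+-identityʳ _) (*-identityˡ _) ⟩
      f y                              ≡⟨ f-resp x~y ⟨
      f x                              ∎
    go {y ∷ ys} (there x∈) (y≁ ∷ u) = begin
      (⟦ _~?_ E x y ⟧ * f y) + ∑ ys _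
        ≡⟨ cong₂ _+_ (cong (_* f y) (⟦⟧-no (_~?_ E x y) (λ x~y → absurd x~y x∈ y≁))) (go x∈ u) ⟩
      (0# * f y) + f x                 ≡⟨ trans (cong (_+ f x) (zeroˡ _)) (+-identityˡ _) ⟩
      f x                              ∎
      where
      absurd : ∀ {y zs} → _~_ E x y → Any (_~_ E x) zs → ¬ All (λ z → ¬ _~_ E y z) zs
      absurd x~y (here x~z) (y≁z ∷ _) = y≁z (~-trans E (~-sym E x~y) x~z)
      absurd x~y (there x∈) (_ ∷ y≁)  = absurd x~y x∈ y≁

  ∑-pick-1 : ∀ (E : Enumeration A) x → ∑ (elements E) (λ y → ⟦ _~?_ E x y ⟧) ≡ 1#
  ∑-pick-1 E x = trans (∑-cong (elements E) (λ _ → sym (*-identityʳ _))) (∑-pick E (λ _ → refl) x)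

  -- Expand `f (φ x)` against the indicator of `φ x ~ y`, exchange the sums, and collapse the sum
  -- over `x` at `ψ y`. The two implications express that `φ` and `ψ` are inverse up to the
  -- equivalences.
  ∑-reindex : ∀ (E : Enumeration A) (F : Enumeration B) (φ : A → B) (ψ : B → A) →
    (∀ x y → _~_ F (φ x) y → _~_ E (ψ y) x) → (∀ x y → _~_ E (ψ y) x → _~_ F (φ x) y) →
    ∀ {f : B → R} → Respects F f → ∑ (elements E) (λ x → f (φ x)) ≡ ∑ (elements F) f
  ∑-reindex E F φ ψ to from {f} f-resp = begin
    ∑ (elements E) (λ x → f (φ x))
      ≡⟨ ∑-cong (elements E) (λ x → ∑-pick F f-resp (φ x)) ⟨
    ∑ (elements E) (λ x → ∑ (elements F) (λ y → ⟦ _~?_ F (φ x) y ⟧ * f y))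
      ≡⟨ ∑-swap (elements E) (elements F) _ ⟩
    ∑ (elements F) (λ y → ∑ (elements E) (λ x → ⟦ _~?_ F (φ x) y ⟧ * f y))
      ≡⟨ ∑-cong (elements F) (λ y → ∑-cong (elements E) (λ x →
           cong (_* f y) (⟦⟧-⇔ (_~?_ F (φ x) y) (_~?_ E (ψ y) x) (to x y) (from x y)))) ⟩
    ∑ (elements F) (λ y → ∑ (elements E) (λ x → ⟦ _~?_ E (ψ y) x ⟧ * f y))
      ≡⟨ ∑-cong (elements F) (λ y → ∑-pick E {λ _ → f y} (λ _ → refl) (ψ y)) ⟩
    ∑ (elements F) f ∎

open Enumeration

open module Sumℕ = Summation ℕ.+-*-isCommutativeSemiring

open +-*-Solver using (solve; con; _:+_; _:*_; _:=_)

∑-1 : ∀ {A : Set} (xs : List A) → ∑ xs (λ _ → 1) ≡ List.length xs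
∑-1 []       = refl
∑-1 (x ∷ xs) = cong suc (∑-1 xs)

∑-mono-≤ : ∀ {A : Set} (xs : List A) {f g : A → ℕ} → (∀ x → f x ≤ g x) → ∑ xs f ≤ ∑ xs g
∑-mono-≤ []       f≤g = z≤n
∑-mono-≤ (x ∷ xs) f≤g = ℕ.+-mono-≤ (f≤g x) (∑-mono-≤ xs f≤g)

allFin-length : ∀ n → ∑ (allFin n) (λ _ → 1) ≡ n
allFin-length n = trans (∑-1 (allFin n)) (List.length-tabulate {n = n} _)

-- Letters and standardisation

letters : ∀ n → Enumeration (Letter n)
letters n = record
  { elements = allLetters n ; ~-isEquivalence = isEquivalence ; _~?_ = _≟ᴸ_
  ; complete = ∈-allLetters ; unique = allLetters-unique n }

allLetters-length : ∀ n → ∑ (allLetters n) (λ _ → 1) ≡ n + n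
allLetters-length n = begin
  ∑ (allLetters n) (λ _ → 1)
    ≡⟨ ∑-cartesianProductWith _,_ (Sign.+ ∷ Sign.- ∷ []) (allFin n) _ ⟩
  ∑ (allFin n) (λ _ → 1) + (∑ (allFin n) (λ _ → 1) + 0)
    ≡⟨ cong₂ _+_ (allFin-length n) (trans (ℕ.+-identityʳ _) (allFin-length n)) ⟩
  n + n ∎
  where
  open ≡-Reasoning

neg-involutive : ∀ {n} (x : Letter n) → neg (neg x) ≡ x
neg-involutive (s , i) = cong (_, i) (Sign.opposite-involutive s)

rank-neg : ∀ {n} (x : Letter n) → suc (rank x + rank (neg x)) ≡ n + n
rank-neg {n} (Sign.+ , i) = begin
  suc (toℕ i + (n + toℕ (opposite i)))    ≡⟨ cong (λ z → suc (toℕ i + (n + z))) (Fin.opposite-prop i) ⟩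
  suc (toℕ i + (n + (n ∸ suc (toℕ i))))   ≡⟨ cong suc (ℕ.+-assoc (toℕ i) n _) ⟨
  suc (toℕ i + n + (n ∸ suc (toℕ i)))
    ≡⟨ cong (λ z → suc (z + (n ∸ suc (toℕ i)))) (ℕ.+-comm (toℕ i) n) ⟩
  suc (n + toℕ i + (n ∸ suc (toℕ i)))     ≡⟨ cong (_+ (n ∸ suc (toℕ i))) (ℕ.+-suc n (toℕ i)) ⟨
  n + suc (toℕ i) + (n ∸ suc (toℕ i))     ≡⟨ ℕ.+-assoc n _ _ ⟩
  n + (suc (toℕ i) + (n ∸ suc (toℕ i)))   ≡⟨ cong (n +_) (ℕ.m+[n∸m]≡n (Fin.toℕ<n i)) ⟩
  n + n                                   ∎
  where open ≡-Reasoning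
rank-neg {n} (Sign.- , i) = trans (cong suc (ℕ.+-comm _ (toℕ i))) (rank-neg (Sign.+ , i))

rank<2n : ∀ {n} (x : Letter n) → rank x < n + n
rank<2n x = subst (suc (rank x) ≤_) (rank-neg x) (s≤s (ℕ.m≤m+n _ _))

rank-injective : ∀ {n} {x y : Letter n} → rank x ≡ rank y → x ≡ y
rank-injective     {x = Sign.+ , i} {Sign.+ , j} eq = cong (Sign.+ ,_) (Fin.toℕ-injective eq)
rank-injective {n} {x = Sign.+ , i} {Sign.- , j} eq =
  contradiction (subst (_< n) eq (Fin.toℕ<n i)) (ℕ.m+n≮m n _)
rank-injective {n} {x = Sign.- , i} {Sign.+ , j} eq =
  contradiction (subst (_< n) (sym eq) (Fin.toℕ<n j)) (ℕ.m+n≮m n _)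
rank-injective {n} {x = Sign.- , i} {Sign.- , j} eq = cong (Sign.- ,_) (begin
  i                       ≡⟨ Fin.opposite-involutive i ⟨
  opposite (opposite i)   ≡⟨ cong opposite (Fin.toℕ-injective (ℕ.+-cancelˡ-≡ n _ _ eq)) ⟩
  opposite (opposite j)   ≡⟨ Fin.opposite-involutive j ⟩
  j                       ∎)
  where open ≡-Reasoning

unrank : ∀ n {m} → m < n + n → ∃ λ (x : Letter n) → rank x ≡ m
unrank n {m} m<2n with m ℕ.<? n
... | yes m<n = (Sign.+ , fromℕ< m<n) , Fin.toℕ-fromℕ< m<n
... | no m≮n  = (Sign.- , opposite (fromℕ< m∸n<n)) , (begin
  n + toℕ (opposite (opposite (fromℕ< m∸n<n)))
    ≡⟨ cong (λ i → n + toℕ i) (Fin.opposite-involutive (fromℕ< m∸n<n)) ⟩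
  n + toℕ (fromℕ< m∸n<n)                        ≡⟨ cong (n +_) (Fin.toℕ-fromℕ< m∸n<n) ⟩
  n + (m ∸ n)                                   ≡⟨ ℕ.m+[n∸m]≡n (ℕ.≮⇒≥ m≮n) ⟩
  m                                             ∎)
  where
  open ≡-Reasoning
  m∸n<n : m ∸ n < n
  m∸n<n = ℕ.+-cancelˡ-< n _ _ (subst (_< n + n) (sym (ℕ.m+[n∸m]≡n (ℕ.≮⇒≥ m≮n))) m<2n)

-- Pigeonhole: punching a missed value out of the codomain would leave an injection into a smaller
-- set.
injective⇒surjective : ∀ {m} (f : Fin m → Fin m) → (∀ {i j} → f i ≡ f j → i ≡ j) → ∀ j → ∃ λ i → f i ≡ j
injective⇒surjective {suc m} f f-inj j with Fin.any? (λ i → f i Fin.≟ j)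
... | yes hit = hit
... | no miss = ⊥-elim (Fin.<⇒notInjective {f = λ i → punchOut (λ j≡fi → miss (i , sym j≡fi))} (ℕ.n<1+n m)
                  (λ eq → f-inj (Fin.punchOut-injective (λ e → miss (_ , sym e)) (λ e → miss (_ , sym e)) eq)))

module _ {n} (f : Letter n → Letter n) (f-injective : ∀ {x y} → f x ≡ f y → x ≡ y)
         (f-odd : ∀ x → f (neg x) ≡ neg (f x)) where

  private
    letter : Fin (n + n) → Letter n
    letter i = proj₁ (unrank n (Fin.toℕ<n i))

    f′ : Fin (n + n) → Fin (n + n)
    f′ i = fromℕ< (rank<2n (f (letter i)))

    f′-injective : ∀ {i j} → f′ i ≡ f′ j → i ≡ j
    f′-injective {i} {j} eq = Fin.toℕ-injective (begin
      toℕ i              ≡⟨ proj₂ (unrank n (Fin.toℕ<n i)) ⟨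
      rank (letter i)
        ≡⟨ cong rank (f-injective (rank-injective (Fin.fromℕ<-injective _ _ (rank<2n (f
              (letter i))) (rank<2n (f (letter j))) eq))) ⟩
      rank (letter j)    ≡⟨ proj₂ (unrank n (Fin.toℕ<n j)) ⟩
      toℕ j              ∎)
      where open ≡-Reasoning

    preimage : ∀ y → ∃ λ x → f x ≡ y
    preimage y with i , eq ← injective⇒surjective f′ f′-injective (fromℕ< (rank<2n y)) =
      letter i , rank-injective (Fin.fromℕ<-injective _ _ (rank<2n (f (letter i))) (rank<2n y) eq)

  -- The inverse comes from pigeonhole: `rank` and `unrank` carry `f` to `Fin (n + n)`, where
  -- injectivity gives preimages.
  fromInjective : SignedPerm n
  fromInjective = signedPerm
    (mk↔ₛ′ f (proj₁ ∘ preimage) (proj₂ ∘ preimage) (λ x → f-injective (proj₂ (preimage (f x))))) f-odd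

-- A letter is sent to the one whose rank is the number of letters with smaller key. By `key-neg`,
-- negation reverses the key order just as it reverses the rank order, which makes the result odd.
module Standardisation {n} (key : Letter n → ℕ) (key-injective : ∀ {x y} → key x ≡ key y → x ≡ y)
  {M} (key-neg : ∀ x → key x + key (neg x) ≡ M) where

  private
    Ls : List (Letter n)
    Ls = allLetters n

    below : Letter n → ℕ
    below x = ∑ Ls (λ y → ⟦ key y ℕ.<? key x ⟧)

    below-< : ∀ {x y} → key x < key y → below x < below y
    below-< {x} {y} x<y = begin-strict
      below x                                           <⟨ ℕ.n<1+n _ ⟩
      suc (below x)                                     ≡⟨ ℕ.+-comm 1 (below x) ⟩
      below x + 1                                       ≡⟨ cong (below x +_) (∑-pick-1 (letters n) x) ⟨
      below x + ∑ Ls (λ z → ⟦ x ≟ᴸ z ⟧)                 ≡⟨ ∑-+ Ls _ _ ⟨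
      ∑ Ls (λ z → ⟦ key z ℕ.<? key x ⟧ + ⟦ x ≟ᴸ z ⟧)    ≤⟨ ∑-mono-≤ Ls step ⟩
      below y                                           ∎
      where
      open ℕ.≤-Reasoning
      step : ∀ z → ⟦ key z ℕ.<? key x ⟧ + ⟦ x ≟ᴸ z ⟧ ≤ ⟦ key z ℕ.<? key y ⟧
      step z with ℕ.<-cmp (key z) (key x)
      ... | tri< z<x _ _ rewrite ⟦⟧-yes (key z ℕ.<? key x) z<x | ⟦⟧-no (x ≟ᴸ z) (λ { refl → ℕ.<-irrefl refl z<x })
          | ⟦⟧-yes (key z ℕ.<? key y) (ℕ.<-trans z<x x<y) = ℕ.≤-refl
      ... | tri≈ _ z≡x _ rewrite key-injective z≡x | ⟦⟧-no (key x ℕ.<? key x) (ℕ.<-irrefl refl) | ⟦⟧-yes (x ≟ᴸ x) refl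
          | ⟦⟧-yes (key x ℕ.<? key y) x<y = ℕ.≤-refl
      ... | tri> z≮x z≢x _ rewrite ⟦⟧-no (key z ℕ.<? key x) z≮x | ⟦⟧-no (x ≟ᴸ z) (λ { refl → z≢x refl }) = z≤n

    key-neg-< : ∀ {x y} → key x < key y → key (neg y) < key (neg x)
    key-neg-< {x} {y} x<y = ℕ.≰⇒> (λ x′≤y′ → ℕ.<-irrefl (trans (key-neg x) (sym (key-neg y))) (ℕ.+-mono-<-≤ x<y x′≤y′))

    -- Negation maps the letters below `neg x` to those above `x`; together with `x` and the letters
    -- below it they exhaust all letters. This mirrors `rank-neg`.
    below-neg : ∀ x → suc (below x + below (neg x)) ≡ n + n
    below-neg x = begin
      suc (below x + below (neg x))
        ≡⟨ cong (λ z → suc (below x + z)) reflected ⟩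
      suc (below x + ∑ Ls (λ y → ⟦ key x ℕ.<? key y ⟧))
        ≡⟨ cong₂ _+_ (sym (∑-pick-1 (letters n) x)) (sym (∑-+ Ls _ _)) ⟩
      ∑ Ls (λ y → ⟦ x ≟ᴸ y ⟧) + ∑ Ls (λ y → ⟦ key y ℕ.<? key x ⟧ + ⟦ key x ℕ.<? key y ⟧)
        ≡⟨ ∑-+ Ls _ _ ⟨
      ∑ Ls (λ y → ⟦ x ≟ᴸ y ⟧ + (⟦ key y ℕ.<? key x ⟧ + ⟦ key x ℕ.<? key y ⟧))
        ≡⟨ ∑-cong Ls trichotomy ⟩
      ∑ Ls (λ _ → 1)
        ≡⟨ allLetters-length n ⟩
      n + n ∎
      where
      open ≡-Reasoning
      reflected : below (neg x) ≡ ∑ Ls (λ y → ⟦ key x ℕ.<? key y ⟧)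
      reflected = begin
        below (neg x)
          ≡⟨ ∑-reindex (letters n) (letters n) neg neg
               (λ { x y refl → neg-involutive x }) (λ { x y refl → neg-involutive y }) (cong _) ⟨
        ∑ Ls (λ y → ⟦ key (neg y) ℕ.<? key (neg x) ⟧)
          ≡⟨ ∑-cong Ls (λ y → ⟦⟧-⇔ (key (neg y) ℕ.<? key (neg x)) (key x ℕ.<? key y)
               (λ lt → subst₂ _<_ (cong key (neg-involutive x)) (cong key (neg-involutive y)) (key-neg-< lt)) key-neg-<) ⟩
        ∑ Ls (λ y → ⟦ key x ℕ.<? key y ⟧) ∎
      trichotomy : ∀ y → ⟦ x ≟ᴸ y ⟧ + (⟦ key y ℕ.<? key x ⟧ + ⟦ key x ℕ.<? key y ⟧) ≡ 1
      trichotomy y with ℕ.<-cmp (key x) (key y)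
      ... | tri< x<y x≢y y≮x rewrite ⟦⟧-no (x ≟ᴸ y) (λ { refl → x≢y refl })
          | ⟦⟧-yes (key x ℕ.<? key y) x<y | ⟦⟧-no (key y ℕ.<? key x) y≮x = refl
      ... | tri≈ x≮y x≡y y≮x rewrite ⟦⟧-yes (x ≟ᴸ y) (key-injective x≡y)
          | ⟦⟧-no (key x ℕ.<? key y) x≮y | ⟦⟧-no (key y ℕ.<? key x) y≮x = refl
      ... | tri> x≮y x≢y y<x rewrite ⟦⟧-no (x ≟ᴸ y) (λ { refl → x≢y refl })
          | ⟦⟧-no (key x ℕ.<? key y) x≮y | ⟦⟧-yes (key y ℕ.<? key x) y<x = refl

    below<2n : ∀ x → below x < n + n
    below<2n x = subst (suc (below x) ≤_) (below-neg x) (s≤s (ℕ.m≤m+n _ _))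

    place : Letter n → Letter n
    place x = proj₁ (unrank n (below<2n x))

    rank-place : ∀ x → rank (place x) ≡ below x
    rank-place x = proj₂ (unrank n (below<2n x))

    place-injective : ∀ {x y} → place x ≡ place y → x ≡ y
    place-injective {x} {y} eq with ℕ.<-cmp (key x) (key y)
      | trans (sym (rank-place x)) (trans (cong rank eq) (rank-place y))
    ... | tri≈ _ x≡y _ | _   = key-injective x≡y
    ... | tri< x<y _ _ | same = contradiction (below-< x<y) (ℕ.<-irrefl same)
    ... | tri> _ _ y<x | same = contradiction (below-< y<x) (ℕ.<-irrefl (sym same))

    place-odd : ∀ x → place (neg x) ≡ neg (place x)
    place-odd x = rank-injective (ℕ.+-cancelˡ-≡ (rank (place x)) _ _ (ℕ.suc-injective (begin
      suc (rank (place x) + rank (place (neg x)))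
        ≡⟨ cong₂ (λ a b → suc (a + b)) (rank-place x) (rank-place (neg x)) ⟩
      suc (below x + below (neg x))                ≡⟨ trans (below-neg x) (sym (rank-neg (place x))) ⟩
      suc (rank (place x) + rank (neg (place x)))  ∎)))
      where open ≡-Reasoning

  standardise : SignedPerm n
  standardise = fromInjective place place-injective place-odd

  standardise-mono : ∀ {x y} → key x < key y → rank (to standardise x) < rank (to standardise y)
  standardise-mono {x} {y} x<y = subst₂ _<_ (sym (rank-place x)) (sym (rank-place y)) (below-< x<y)

  standardise-cancel : ∀ {x y} → rank (to standardise x) < rank (to standardise y) → key x < key y
  standardise-cancel {x} {y} lt with ℕ.<-cmp (key x) (key y)
  ... | tri< x<y _ _ = x<y
  ... | tri≈ _ x≡y _ = contradiction lt (ℕ.<-irrefl (cong (rank ∘ to standardise) (key-injective x≡y)))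
  ... | tri> _ _ y<x = contradiction lt (ℕ.<-asym (standardise-mono y<x))

-- Descents and sorting by digits

word-cong : ∀ {n} (σ τ : SignedPerm n) → σ ≈ τ → word σ ≡ word τ
word-cong σ τ σ≈τ = Vec.tabulate-cong (σ≈τ ∘ pos)

toℕ-d : ∀ {n} (σ : SignedPerm n) → toℕ (d σ) ≡ descents (word σ)
toℕ-d σ = Fin.toℕ-fromℕ< _

d-cong : ∀ {n} (σ τ : SignedPerm n) → σ ≈ τ → d σ ≡ d τ
d-cong σ τ σ≈τ = Fin.toℕ-injective
  (trans (toℕ-d σ) (trans (cong descents (word-cong σ τ σ≈τ)) (sym (toℕ-d τ))))

to-injective : ∀ {n} (σ : SignedPerm n) {x y} → to σ x ≡ to σ y → x ≡ y
to-injective σ {x} {y} eq =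
  trans (sym (SignedPerm.strictlyInverseʳ σ x)) (trans (cong (from σ) eq) (SignedPerm.strictlyInverseʳ σ y))

pos-determines : ∀ {n} (σ τ : SignedPerm n) → (∀ i → to σ (pos i) ≡ to τ (pos i)) → σ ≈ τ
pos-determines σ τ eq (Sign.+ , i) = eq i
pos-determines σ τ eq (Sign.- , i) =
  trans (SignedPerm.odd σ (pos i)) (trans (cong neg (eq i)) (sym (SignedPerm.odd τ (pos i))))

module _ {n : ℕ} where

  ascent : ∀ {x y : Letter n} → ⟦ x ≻? y ⟧ ≡ 0 → x ≢ y → rank x < rank y
  ascent {x} {y} eq x≢y with ℕ.<-cmp (rank x) (rank y)
  ... | tri< x<y _ _ = x<y
  ... | tri≈ _ x≡y _ = contradiction (rank-injective x≡y) x≢y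
  ... | tri> _ _ y<x = contradiction (trans (sym eq) (⟦⟧-yes (x ≻? y) y<x)) λ ()

  Injective : ∀ {k} → (Fin k → Letter n) → Set
  Injective g = ∀ {i j} → g i ≡ g j → i ≡ j

  first-ascent : ∀ {k} (g : Fin (suc (suc k)) → Letter n) → Injective g → descents (tabulate g) ≡ 0 →
    rank (g zero) < rank (g (suc zero))
  first-ascent g g-inj none = ascent (ℕ.m+n≡0⇒m≡0 _ none) (λ eq → contradiction (g-inj eq) λ ())

  -- Count back from the end: without a final descent the last letter is positive, hence of rank
  -- below `n`, and every earlier position loses at least one.
  rank-upper : ∀ {k} (g : Fin k → Letter n) → Injective g → descents (tabulate g) ≡ 0 →
    ∀ i → rank (g i) + k ≤ n + toℕ i
  rank-upper {suc zero} g g-inj none zero with g zero | none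
  ... | Sign.+ , i | _ = subst₂ _≤_ (ℕ.+-comm 1 _) (sym (ℕ.+-identityʳ n)) (Fin.toℕ<n i)
  rank-upper {suc (suc k)} g g-inj none zero = begin
    rank (g zero) + suc (suc k)        ≡⟨ ℕ.+-suc _ (suc k) ⟩
    suc (rank (g zero)) + suc k        ≤⟨ ℕ.+-monoˡ-≤ (suc k) (first-ascent g g-inj none) ⟩
    rank (g (suc zero)) + suc k
      ≤⟨ rank-upper (g ∘ suc) (Fin.suc-injective ∘ g-inj) (ℕ.m+n≡0⇒n≡0 ⟦ g zero ≻? g (suc zero) ⟧ none) zero ⟩
    n + 0                              ∎
    where open ℕ.≤-Reasoning
  rank-upper {suc (suc k)} g g-inj none (suc i) =
    subst₂ _≤_ (sym (ℕ.+-suc _ (suc k))) (sym (ℕ.+-suc n (toℕ i)))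
      (s≤s (rank-upper (g ∘ suc) (Fin.suc-injective ∘ g-inj) (ℕ.m+n≡0⇒n≡0 ⟦ g zero ≻? g (suc zero) ⟧ none) i))

  rank-lower : ∀ {k} (g : Fin (suc k) → Letter n) → Injective g → descents (tabulate g) ≡ 0 →
    ∀ {l} → l ≤ rank (g zero) → ∀ i → l + toℕ i ≤ rank (g i)
  rank-lower {k} g g-inj none l≤ zero = subst (_≤ rank (g zero)) (sym (ℕ.+-identityʳ _)) l≤
  rank-lower {suc k} g g-inj none {l} l≤ (suc i) = subst (_≤ rank (g (suc i))) (sym (ℕ.+-suc l (toℕ i)))
    (rank-lower (g ∘ suc) (Fin.suc-injective ∘ g-inj) (ℕ.m+n≡0⇒n≡0 ⟦ g zero ≻? g (suc zero) ⟧ none)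
      (ℕ.≤-<-trans l≤ (first-ascent g g-inj none)) i)

-- The ranks rise strictly along the whole word, starting at 0 or more and ending below the length
-- of the word, so the two bounds meet at every position.
no-descents⇒id : ∀ {n} (σ : SignedPerm n) → descents (word σ) ≡ 0 → σ ≈ idₛ
no-descents⇒id {zero}  σ none (_ , ())
no-descents⇒id {suc n} σ none = pos-determines σ idₛ λ i → rank-injective (ℕ.≤-antisym
  (ℕ.+-cancelˡ-≤ (suc n) _ _ (subst (_≤ suc n + toℕ i) (ℕ.+-comm _ (suc n)) (rank-upper g g-injective none i)))
  (rank-lower g g-injective none z≤n i))
  where
  g : Fin (suc n) → Letter (suc n)
  g = to σ ∘ pos
  g-injective : Injective g
  g-injective eq = cong proj₂ (to-injective σ eq)

id-no-descents : ∀ {n} → descents (word (idₛ {n})) ≡ 0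
id-no-descents {n} = go {n} (λ i → i) (λ i<j → i<j)
  where
  go : ∀ {k} (g : Fin k → Fin n) → (∀ {i j} → toℕ i < toℕ j → toℕ (g i) < toℕ (g j)) →
    descents (tabulate (pos ∘ g)) ≡ 0
  go {zero}        g mono = refl
  go {suc zero}    g mono = refl
  go {suc (suc k)} g mono = cong₂ _+_
    (⟦⟧-no (pos (g zero) ≻? pos (g (suc zero))) (ℕ.<-asym (mono {zero} {suc zero} (s≤s z≤n))))
    (go (g ∘ suc) (mono ∘ s≤s))

lex-< : ∀ {M a c r s} → r < M → a < c → a * M + r < c * M + s
lex-< {M} {a} {c} {r} {s} r<M a<c = begin-strict
  a * M + r    <⟨ ℕ.+-monoʳ-< (a * M) r<M ⟩
  a * M + M    ≡⟨ ℕ.+-comm (a * M) M ⟩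
  suc a * M    ≤⟨ ℕ.*-monoˡ-≤ M a<c ⟩
  c * M        ≤⟨ ℕ.m≤m+n (c * M) s ⟩
  c * M + s    ∎
  where open ℕ.≤-Reasoning

lex-<⁻¹ : ∀ {M a c r s} → s < M → a * M + r < c * M + s → a < c ⊎ (a ≡ c × r < s)
lex-<⁻¹ {M} {a} {c} s<M lt with ℕ.<-cmp a c
... | tri< a<c _ _ = inj₁ a<c
... | tri≈ _ refl _ = inj₂ (refl , ℕ.+-cancelˡ-< (a * M) _ _ lt)
... | tri> _ _ c<a = contradiction lt (ℕ.<-asym (lex-< s<M c<a))

-- The negative letters form the upper half of the order. Hence a final descent is an ordinary
-- descent from the last letter to its opposite, and the comparison rule for sorters covers it too.
finalDescent-neg : ∀ {n} (x : Letter n) → finalDescent x ≡ ⟦ x ≻? neg x ⟧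
finalDescent-neg {n} x@(Sign.+ , i) = sym (⟦⟧-no (x ≻? neg x) (λ lt → ℕ.m+n≮m n _ (ℕ.<-trans lt (Fin.toℕ<n i))))
finalDescent-neg {n} x@(Sign.- , i) = sym (⟦⟧-yes (x ≻? neg x) (ℕ.<-≤-trans (Fin.toℕ<n i) (ℕ.m≤m+n n _)))

finalDescent≤1 : ∀ {n} (x : Letter n) → finalDescent x ≤ 1
finalDescent≤1 (Sign.+ , _) = z≤n
finalDescent≤1 (Sign.- , _) = ℕ.≤-refl

module DigitSorting (b : ℕ) where

  extend : ∀ {n} → Vec (Digit b) n → Letter n → Digit b
  extend h (Sign.+ , i) = lookup h i
  extend h (Sign.- , i) = opposite (lookup h i)

  extend-neg : ∀ {n} (h : Vec (Digit b) n) x → extend h (neg x) ≡ opposite (extend h x)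
  extend-neg h (Sign.+ , i) = refl
  extend-neg h (Sign.- , i) = sym (Fin.opposite-involutive (lookup h i))

  opposite-sum : (a : Digit b) → toℕ a + toℕ (opposite a) ≡ 2 * b
  opposite-sum a = trans (cong (toℕ a +_) (Fin.opposite-prop a)) (ℕ.m+[n∸m]≡n (Fin.toℕ≤pred[n] a))

  -- The descents of sorter h ∘ₛ ρ, read off from the word of ρ and the digits a = h ∘ ρ:
  -- letters are compared by digit first, and the last letter becomes negative when its
  -- digit exceeds b (the digit of the opposite letter is 2b - a).
  borrows : ∀ {n k} → Vec (Letter n) k → Vec (Digit b) k → ℕ
  borrows []              []              = 0
  borrows (x ∷ [])        (a ∷ [])        = ⟦ b ℕ.<? toℕ a + finalDescent x ⟧
  borrows (x ∷ w@(y ∷ _)) (a ∷ as@(c ∷ _)) = ⟦ toℕ c ℕ.<? toℕ a + ⟦ x ≻? y ⟧ ⟧ + borrows w as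

  module _ {n : ℕ} (h : Vec (Digit b) n) where

    -- Encodes the lexicographic order on (digit , letter).
    key : Letter n → ℕ
    key x = toℕ (extend h x) * (n + n) + rank x

    key-injective : ∀ {x y} → key x ≡ key y → x ≡ y
    key-injective {x} {y} eq with ℕ.<-cmp (toℕ (extend h x)) (toℕ (extend h y))
    ... | tri< lt _ _ = contradiction (lex-< {s = rank y} (rank<2n x) lt) (ℕ.<-irrefl eq)
    ... | tri> _ _ gt = contradiction (lex-< {s = rank x} (rank<2n y) gt) (ℕ.<-irrefl (sym eq))
    ... | tri≈ _ e _  = rank-injective (ℕ.+-cancelˡ-≡ (toℕ (extend h x) * (n + n)) _ _
                          (trans eq (cong (λ z → z * (n + n) + rank y) (sym e))))

    key-neg : ∀ x → key x + key (neg x) ≡ 2 * b * (n + n) + ℕ.pred (n + n)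
    key-neg x = begin
      e * M + rank x + (toℕ (extend h (neg x)) * M + rank (neg x))
        ≡⟨ cong (λ z → e * M + rank x + (toℕ z * M + rank (neg x))) (extend-neg h x) ⟩
      e * M + rank x + (e′ * M + rank (neg x))
        ≡⟨ solve 5 (λ e M r e′ r′ → e :* M :+ r :+ (e′ :* M :+ r′) := (e :+ e′) :* M :+ (r :+ r′)) refl
             e M (rank x) e′ (rank (neg x)) ⟩
      (e + e′) * M + (rank x + rank (neg x))
        ≡⟨ cong₂ (λ y z → y * M + z) (opposite-sum (extend h x)) (cong ℕ.pred (rank-neg x)) ⟩
      2 * b * M + ℕ.pred M ∎
      where
      open ≡-Reasoning
      M  = n + n
      e  = toℕ (extend h x)
      e′ = toℕ (opposite (extend h x))

    open Standardisation key (λ {x} {y} → key-injective {x} {y}) key-neg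

    -- Abstract to keep the rank computation from unfolding during conversion checking.
    abstract
      sorter : SignedPerm n
      sorter = standardise

      sorter-mono : ∀ {x y} → key x < key y → rank (to sorter x) < rank (to sorter y)
      sorter-mono = standardise-mono

      sorter-cancel : ∀ {x y} → rank (to sorter x) < rank (to sorter y) → key x < key y
      sorter-cancel = standardise-cancel

    -- The tie-break folds into the digit comparison: "smaller digit, or equal digit and already a
    -- descent" becomes one strict inequality once the descent bit is added to the digit of `x`.
    sorter-descent : ∀ x y →
      ⟦ to sorter x ≻? to sorter y ⟧ ≡ ⟦ toℕ (extend h y) ℕ.<? toℕ (extend h x) + ⟦ x ≻? y ⟧ ⟧
    sorter-descent x y = ⟦⟧-⇔ (to sorter x ≻? to sorter y) (toℕ (extend h y) ℕ.<? toℕ (extend h x) + ⟦ x ≻? y ⟧)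
      (λ lt → forth (lex-<⁻¹ (rank<2n x) (sorter-cancel {y} {x} lt)))
      (λ lt → sorter-mono {y} {x} (back (x ≻? y) lt))
      where
      forth : toℕ (extend h y) < toℕ (extend h x) ⊎ (toℕ (extend h y) ≡ toℕ (extend h x) × rank y < rank x) →
        toℕ (extend h y) < toℕ (extend h x) + ⟦ x ≻? y ⟧
      forth (inj₁ lt)         = ℕ.<-≤-trans lt (ℕ.m≤m+n _ _)
      forth (inj₂ (eq , lt)) rewrite ⟦⟧-yes (x ≻? y) lt = subst₂ _≤_ (cong suc (sym eq)) (ℕ.+-comm 1 _) ℕ.≤-refl
      back : (p : Dec (rank y < rank x)) → toℕ (extend h y) < toℕ (extend h x) + ⟦ p ⟧ → key y < key x
      back (yes y<x) lt with ℕ.m<1+n⇒m<n∨m≡n (subst (toℕ (extend h y) <_) (ℕ.+-comm _ 1) lt)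
      ... | inj₁ lt′ = lex-< (rank<2n y) lt′
      ... | inj₂ eq  = subst (λ z → key y < z * (n + n) + rank x) eq (ℕ.+-monoʳ-< _ y<x)
      back (no _) lt = lex-< (rank<2n y) (subst (toℕ (extend h y) <_) (ℕ.+-identityʳ _) lt)

    -- The opposite letter has digit `2b - e`, so the test is `2b < 2e + f`; for a bit `f` this
    -- agrees with `b < e + f`.
    sorter-finalDescent : ∀ x → finalDescent (to sorter x) ≡ ⟦ b ℕ.<? toℕ (extend h x) + finalDescent x ⟧
    sorter-finalDescent x = begin
      finalDescent (to sorter x)                          ≡⟨ finalDescent-neg (to sorter x) ⟩
      ⟦ to sorter x ≻? neg (to sorter x) ⟧
        ≡⟨ cong (λ z → ⟦ to sorter x ≻? z ⟧) (SignedPerm.odd sorter x) ⟨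
      ⟦ to sorter x ≻? to sorter (neg x) ⟧                ≡⟨ sorter-descent x (neg x) ⟩
      ⟦ toℕ (extend h (neg x)) ℕ.<? e + ⟦ x ≻? neg x ⟧ ⟧
        ≡⟨ cong₂ (λ y z → ⟦ toℕ y ℕ.<? e + z ⟧) (extend-neg h x) (sym (finalDescent-neg x)) ⟩
      ⟦ e′ ℕ.<? e + f ⟧
        ≡⟨ ⟦⟧-⇔ (e′ ℕ.<? e + f) (b ℕ.<? e + f) forth back ⟩
      ⟦ b ℕ.<? e + f ⟧                                    ∎
      where
      e  = toℕ (extend h x)
      e′ = toℕ (opposite (extend h x))
      f  = finalDescent x
      forth : e′ < e + f → b < e + f
      forth lt = ℕ.≰⇒> λ e+f≤b → ℕ.<-irrefl refl (let open ℕ.≤-Reasoning in begin-strict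
        2 * b              ≡⟨ opposite-sum (extend h x) ⟨
        e + e′             <⟨ ℕ.+-monoʳ-< e lt ⟩
        e + (e + f)        ≤⟨ ℕ.+-monoˡ-≤ (e + f) (ℕ.m≤m+n e f) ⟩
        e + f + (e + f)    ≤⟨ ℕ.+-mono-≤ e+f≤b e+f≤b ⟩
        b + b              ≡⟨ solve 1 (λ b → b :+ b := con 2 :* b) refl b ⟩
        2 * b              ∎)
      back : b < e + f → e′ < e + f
      back lt = ℕ.≰⇒> λ e+f≤e′ → ℕ.<-irrefl refl (let open ℕ.≤-Reasoning in begin-strict
        suc (2 * b)              ≡⟨ solve 1 (λ b → con 1 :+ con 2 :* b := (con 1 :+ b) :+ b) refl b ⟩
        suc b + b                <⟨ ℕ.+-mono-≤-< lt lt ⟩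
        e + f + (e + f)          ≤⟨ ℕ.+-monoʳ-≤ (e + f) e+f≤e′ ⟩
        e + f + e′               ≡⟨ solve 3 (λ e f e′ → e :+ f :+ e′ := f :+ (e :+ e′)) refl e f e′ ⟩
        f + (e + e′)             ≡⟨ cong (f +_) (opposite-sum (extend h x)) ⟩
        f + 2 * b                ≤⟨ ℕ.+-monoˡ-≤ (2 * b) (finalDescent≤1 x) ⟩
        suc (2 * b)              ∎)
      open ≡-Reasoning

    descents-sorted : ∀ {k} (w : Vec (Letter n) k) →
      descents (Vec.map (to sorter) w) ≡ borrows w (Vec.map (extend h) w)
    descents-sorted []              = refl
    descents-sorted (x ∷ [])        = sorter-finalDescent x
    descents-sorted (x ∷ w@(y ∷ _)) = cong₂ _+_ (sorter-descent x y) (descents-sorted w)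

    descents-sorter : ∀ ρ → descents (word (sorter ∘ₛ ρ)) ≡ borrows (word ρ) (Vec.map (extend h) (word ρ))
    descents-sorter ρ = trans (cong descents (Vec.tabulate-∘ (to sorter) (to ρ ∘ pos))) (descents-sorted (word ρ))

open ≡-Reasoning

-- Descents of sorters as carries

∑-allFin-suc : ∀ {k} (f : Fin (suc k) → ℕ) → ∑ (allFin (suc k)) f ≡ f zero + ∑ (allFin k) (f ∘ suc)
∑-allFin-suc {k} f = cong (f zero +_)
  (trans (cong (λ xs → ∑ xs f) (sym (List.map-tabulate {n = k} id suc))) (∑-map suc (allFin k) f))

∑-range-+ : ∀ s t (f : ℕ → ℕ) →
  ∑ (allFin (s + t)) (f ∘ toℕ) ≡ ∑ (allFin s) (f ∘ toℕ) + ∑ (allFin t) (λ i → f (s + toℕ i))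
∑-range-+ zero    t f = refl
∑-range-+ (suc s) t f = begin
  ∑ (allFin (suc s + t)) (f ∘ toℕ)
    ≡⟨ ∑-allFin-suc {s + t} (f ∘ toℕ) ⟩
  f 0 + ∑ (allFin (s + t)) (f ∘ suc ∘ toℕ)
    ≡⟨ cong (f 0 +_) (∑-range-+ s t (f ∘ suc)) ⟩
  f 0 + (∑ (allFin s) (f ∘ suc ∘ toℕ) + ∑ (allFin t) (λ i → f (suc s + toℕ i)))
    ≡⟨ ℕ.+-assoc (f 0) _ _ ⟨
  f 0 + ∑ (allFin s) (f ∘ suc ∘ toℕ) + ∑ (allFin t) (λ i → f (suc s + toℕ i))
    ≡⟨ cong (_+ ∑ (allFin t) (λ i → f (suc s + toℕ i))) (∑-allFin-suc {s} (f ∘ toℕ)) ⟨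
  ∑ (allFin (suc s)) (f ∘ toℕ) + ∑ (allFin t) (λ i → f (suc s + toℕ i)) ∎

-- Raising the values below `s` by `N` turns the range `0, …, N - 1` into the window
-- `s, …, s + N - 1`. This is subtraction of `s` modulo `N`, with the borrow kept as a multiple of
-- `N`.
∑-rotate : ∀ {s N} → s ≤ N → (g : ℕ → ℕ) →
  ∑ (allFin N) (λ c → g (⟦ toℕ c ℕ.<? s ⟧ * N + toℕ c)) ≡ ∑ (allFin N) (λ x → g (s + toℕ x))
∑-rotate {s} s≤N g with t , refl ← ℕ.m≤n⇒∃[o]m+o≡n s≤N = begin
  ∑ (allFin N) (λ c → h (toℕ c))
    ≡⟨ ∑-range-+ s t h ⟩
  ∑ (allFin s) (h ∘ toℕ) + ∑ (allFin t) (λ i → h (s + toℕ i))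
    ≡⟨ cong₂ _+_ (∑-cong (allFin s) low) (∑-cong (allFin t) high) ⟩
  ∑ (allFin s) (λ i → g (s + (t + toℕ i))) + ∑ (allFin t) (λ i → g (s + toℕ i))
    ≡⟨ ℕ.+-comm _ (∑ (allFin t) (λ i → g (s + toℕ i))) ⟩
  ∑ (allFin t) (λ i → g (s + toℕ i)) + ∑ (allFin s) (λ i → g (s + (t + toℕ i)))
    ≡⟨ ∑-range-+ t s (g ∘ (s +_)) ⟨
  ∑ (allFin (t + s)) (λ x → g (s + toℕ x))
    ≡⟨ cong (λ m → ∑ (allFin m) (λ x → g (s + toℕ x))) (ℕ.+-comm t s) ⟩
  ∑ (allFin N) (λ x → g (s + toℕ x)) ∎
  where
  N = s + t
  h : ℕ → ℕ
  h m = g (⟦ m ℕ.<? s ⟧ * N + m)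
  low : ∀ i → h (toℕ i) ≡ g (s + (t + toℕ i))
  low i rewrite ⟦⟧-yes (toℕ i ℕ.<? s) (Fin.toℕ<n i) | ℕ.+-identityʳ (s + t) = cong g (ℕ.+-assoc s t (toℕ i))
  high : ∀ i → h (s + toℕ i) ≡ g (s + toℕ i)
  high i rewrite ⟦⟧-no (s + toℕ i ℕ.<? s) (ℕ.m+n≮m s _) = refl

digitVecs : ∀ b k → List (Vec (Digit b) k)
digitVecs b k = allVecs (allFin (suc (2 * b))) k

module Carries (b : ℕ) where

  open DigitSorting b

  private
    N : ℕ
    N = suc (2 * b)

    Ds : List (Digit b)
    Ds = allFin N

  ∑-digitVecs-suc : ∀ {k} (f : Vec (Digit b) (suc k) → ℕ) →
    ∑ (digitVecs b (suc k)) f ≡ ∑ Ds (λ a → ∑ (digitVecs b k) (λ as → f (a ∷ as)))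
  ∑-digitVecs-suc {k} f = ∑-cartesianProductWith _∷_ Ds (digitVecs b k) f

  -- As `N = 2b + 1`, exceeding `b` means that adding `b` reaches `N`, while `m ≤ N` keeps the sum
  -- below `2N`. The final descent thereby supplies the summand `b` of the carry.
  carry-out : ∀ {m} → m ≤ N → ⟦ b ℕ.<? m ⟧ ≡ (b + m) / N
  carry-out {m} m≤N with b ℕ.<? m
  ... | no b≮m = trans (⟦⟧-no (b ℕ.<? m) b≮m) (sym (m<n⇒m/n≡0 (s≤s (subst (b + m ≤_)
                   (cong (b +_) (sym (ℕ.+-identityʳ b))) (ℕ.+-monoʳ-≤ b (ℕ.≮⇒≥ b≮m))))))
  ... | yes b<m = trans (⟦⟧-yes (b ℕ.<? m) b<m) (sym (begin
    (b + m) / N               ≡⟨ m/n≡1+[m∸n]/n (subst (_≤ b + m) N≡ (ℕ.+-monoʳ-≤ b b<m)) ⟩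
    1 + (b + m ∸ N) / N
      ≡⟨ cong suc (m<n⇒m/n≡0 (ℕ.<-≤-trans (s≤s (ℕ.m≤n+o⇒m∸n≤o (b + m) N b+m≤)) (s≤s (ℕ.m≤m+n b _)))) ⟩
    1                         ∎))
    where
    N≡ : b + suc b ≡ N
    N≡ = solve 1 (λ b → b :+ (con 1 :+ b) := con 1 :+ con 2 :* b) refl b
    b+m≤ : b + m ≤ N + b
    b+m≤ = subst (b + m ≤_) (ℕ.+-comm b N) (ℕ.+-monoʳ-≤ b m≤N)

  borrow-carry : ∀ c m → c + m / N ≡ (c * N + m) / N
  borrow-carry c m = begin
    c + m / N            ≡⟨ cong (_+ m / N) (m*n/n≡m c N) ⟨
    c * N / N + m / N    ≡⟨ +-distrib-/-∣ˡ m (n∣m*n c) ⟨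
    (c * N + m) / N      ∎

  -- The digit c and the borrow from a + δ to c are exchanged for the digit x with
  -- a + δ + x = c or c + N; the borrows then telescope into the carry of the column sum.
  ∑-borrows-∷ : ∀ {n k} (x : Letter n) (w : Vec (Letter n) k) (a : Digit b) (f : ℕ → ℕ) →
    ∑ (digitVecs b k) (λ as → f (borrows (x ∷ w) (a ∷ as))) ≡
    ∑ (digitVecs b k) (λ as → f ((descents (x ∷ w) + b + toℕ a + digitSum as) / N))
  ∑-borrows-∷ x [] a f = cong (λ q → f q + 0) (begin
    ⟦ b ℕ.<? toℕ a + finalDescent x ⟧
      ≡⟨ carry-out (subst (toℕ a + finalDescent x ≤_) (ℕ.+-comm (2 * b) 1) (ℕ.+-mono-≤
            (Fin.toℕ≤pred[n] a) (finalDescent≤1 x))) ⟩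
    (b + (toℕ a + finalDescent x)) / N
      ≡⟨ cong (_/ N) (solve 3 (λ b a f → b :+ (a :+ f) := f :+ b :+ a :+ con 0) refl b (toℕ a) (finalDescent x)) ⟩
    (finalDescent x + b + toℕ a + 0) / N       ∎)
  ∑-borrows-∷ {n} {suc k} x w@(y ∷ u) a f = begin
    ∑ (digitVecs b (suc k)) (λ as → f (borrows (x ∷ w) (a ∷ as)))
      ≡⟨ ∑-digitVecs-suc {k} _ ⟩
    ∑ Ds (λ c → ∑ Vs (λ as → f (⟦ toℕ c ℕ.<? s ⟧ + borrows w (c ∷ as))))
      -- The test function is arbitrary, so the leading borrow can be absorbed into it before the
      -- induction hypothesis is applied.
      ≡⟨ ∑-cong Ds (λ c → ∑-borrows-∷ y u c (λ m → f (⟦ toℕ c ℕ.<? s ⟧ + m))) ⟩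
    ∑ Ds (λ c → ∑ Vs (λ as → f (⟦ toℕ c ℕ.<? s ⟧ + (D + b + toℕ c + digitSum as) / N)))
      ≡⟨ ∑-cong Ds (λ c → ∑-cong Vs (λ as → cong f (trans (borrow-carry ⟦ toℕ c ℕ.<? s ⟧ (D + b + toℕ c + digitSum as))
           (cong (_/ N) (solve 5 (λ r D b c z → r :+ (D :+ b :+ c :+ z) := r :+ c :+ (D :+ b :+ z)) refl
             (⟦ toℕ c ℕ.<? s ⟧ * N) D b (toℕ c) (digitSum as)))))) ⟩
    ∑ Ds (λ c → ∑ Vs (λ as → f ((⟦ toℕ c ℕ.<? s ⟧ * N + toℕ c + (D + b + digitSum as)) / N)))
      ≡⟨ ∑-swap Ds Vs _ ⟩
    ∑ Vs (λ as → ∑ Ds (λ c → f ((⟦ toℕ c ℕ.<? s ⟧ * N + toℕ c + (D + b + digitSum as)) / N)))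
      ≡⟨ ∑-cong Vs (λ as → ∑-rotate s≤N (λ m → f ((m + (D + b + digitSum as)) / N))) ⟩
    ∑ Vs (λ as → ∑ Ds (λ c → f ((s + toℕ c + (D + b + digitSum as)) / N)))
      ≡⟨ ∑-swap Vs Ds _ ⟩
    ∑ Ds (λ c → ∑ Vs (λ as → f ((s + toℕ c + (D + b + digitSum as)) / N)))
      ≡⟨ ∑-cong Ds (λ c → ∑-cong Vs (λ as → cong (λ m → f (m / N))
           (solve 6 (λ a e c D b z → a :+ e :+ c :+ (D :+ b :+ z) := e :+ D :+ b :+ a :+ (c :+ z)) refl
             (toℕ a) ⟦ x ≻? y ⟧ (toℕ c) D b (digitSum as)))) ⟩
    ∑ Ds (λ c → ∑ Vs (λ as → f ((descents (x ∷ w) + b + toℕ a + digitSum (c ∷ as)) / N)))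
      ≡⟨ ∑-digitVecs-suc {k} _ ⟨
    ∑ (digitVecs b (suc k)) (λ as → f ((descents (x ∷ w) + b + toℕ a + digitSum as) / N)) ∎
    where
    s = toℕ a + ⟦ x ≻? y ⟧
    D = descents w
    Vs = digitVecs b k
    ⟦⟧≤1 : ∀ {X : Set} (p : Dec X) → ⟦ p ⟧ ≤ 1
    ⟦⟧≤1 (yes _) = ℕ.≤-refl
    ⟦⟧≤1 (no _)  = z≤n
    s≤N : s ≤ N
    s≤N = subst (s ≤_) (ℕ.+-comm (2 * b) 1) (ℕ.+-mono-≤ (Fin.toℕ≤pred[n] a) (⟦⟧≤1 (x ≻? y)))

  ∑-borrows : ∀ {n k} (w : Vec (Letter n) (suc k)) (f : ℕ → ℕ) →
    ∑ (digitVecs b (suc k)) (λ as → f (borrows w as)) ≡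
    ∑ (digitVecs b (suc k)) (λ as → f ((descents w + b + digitSum as) / N))
  ∑-borrows {n} {k} w@(x ∷ u) f = begin
    ∑ (digitVecs b (suc k)) (λ as → f (borrows w as))
      ≡⟨ ∑-digitVecs-suc {k} _ ⟩
    ∑ Ds (λ a → ∑ (digitVecs b k) (λ as → f (borrows w (a ∷ as))))
      ≡⟨ ∑-cong Ds (λ a → ∑-borrows-∷ x u a f) ⟩
    ∑ Ds (λ a → ∑ (digitVecs b k) (λ as → f ((descents w + b + toℕ a + digitSum as) / N)))
      ≡⟨ ∑-cong Ds (λ a → ∑-cong (digitVecs b k) (λ as → cong (λ m → f (m / N)) (ℕ.+-assoc
            (descents w + b) (toℕ a) (digitSum as)))) ⟩
    ∑ Ds (λ a → ∑ (digitVecs b k) (λ as → f ((descents w + b + digitSum (a ∷ as)) / N)))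
      ≡⟨ ∑-digitVecs-suc {k} _ ⟨
    ∑ (digitVecs b (suc k)) (λ as → f ((descents w + b + digitSum as) / N)) ∎

  relabel : ∀ {n} → SignedPerm n → Vec (Digit b) n → Vec (Digit b) n
  relabel ρ h = Vec.map (extend h) (word ρ)

  extend-relabel : ∀ {n} (ρ : SignedPerm n) h x → extend (relabel ρ h) x ≡ extend h (to ρ x)
  extend-relabel ρ h (Sign.+ , i) =
    trans (Vec.lookup-map i (extend h) (word ρ)) (cong (extend h) (Vec.lookup∘tabulate (to ρ ∘ pos) i))
  extend-relabel ρ h (Sign.- , i) = begin
    opposite (extend (relabel ρ h) (pos i))    ≡⟨ cong opposite (extend-relabel ρ h (pos i)) ⟩
    opposite (extend h (to ρ (pos i)))         ≡⟨ extend-neg h (to ρ (pos i)) ⟨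
    extend h (neg (to ρ (pos i)))              ≡⟨ cong (extend h) (SignedPerm.odd ρ (pos i)) ⟨
    extend h (to ρ (neg (pos i)))              ∎

  relabel-inverse : ∀ {n} (ρ : SignedPerm n) h → relabel (ρ ⁻¹) (relabel ρ h) ≡ h
  relabel-inverse ρ h = begin
    Vec.map (extend (relabel ρ h)) (word (ρ ⁻¹))
      ≡⟨ Vec.tabulate-∘ (extend (relabel ρ h)) (from ρ ∘ pos) ⟨
    tabulate (λ i → extend (relabel ρ h) (from ρ (pos i)))
      ≡⟨ Vec.tabulate-cong (λ i → trans (extend-relabel ρ h _) (cong (extend h)
            (SignedPerm.strictlyInverseˡ ρ (pos i)))) ⟩
    tabulate (lookup h)                                    ≡⟨ Vec.tabulate∘lookup h ⟩
    h                                                      ∎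

  digitVecsᴱ : ∀ k → Enumeration (Vec (Digit b) k)
  digitVecsᴱ = vecs Fin._≟_ ∈-allFin (allFin⁺ N)

  -- The digits matter only as read along the word of `ρ`, and `relabel ρ` permutes the digit
  -- vectors, so that reading can be summed over freely. What remains sees `ρ` only through its
  -- number of descents.
  ∑-descents-sorter : ∀ {k} (ρ : SignedPerm (suc k)) (f : ℕ → ℕ) →
    ∑ (digitVecs b (suc k)) (λ h → f (descents (word (sorter h ∘ₛ ρ)))) ≡
    ∑ (digitVecs b (suc k)) (λ as → f ((descents (word ρ) + b + digitSum as) / N))
  ∑-descents-sorter {k} ρ f = begin
    ∑ Vs (λ h → f (descents (word (sorter h ∘ₛ ρ))))
      ≡⟨ ∑-cong Vs (λ h → cong f (descents-sorter h ρ)) ⟩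
    ∑ Vs (λ h → f (borrows (word ρ) (relabel ρ h)))
      ≡⟨ ∑-reindex (digitVecsᴱ (suc k)) (digitVecsᴱ (suc k)) (relabel ρ) (relabel (ρ ⁻¹))
           (λ { h _ refl → relabel-inverse ρ h }) (λ { _ h refl → relabel-inverse (ρ ⁻¹) h }) (cong _) ⟩
    ∑ Vs (λ h → f (borrows (word ρ) h))                 ≡⟨ ∑-borrows (word ρ) f ⟩
    ∑ Vs (λ as → f ((descents (word ρ) + b + digitSum as) / N)) ∎
    where Vs = digitVecs b (suc k)

  -- Stars and bars: since `m < N`, the upper bound on a single digit never interferes.
  count-digitSum≤ : ∀ k {m} → m < N → ∑ (digitVecs b k) (λ as → ⟦ digitSum as ℕ.≤? m ⟧) ≡ (k + m) C k
  count-digitSum≤ zero    {m} m<N = sym (trans (nCk≡nC[n∸k] {n = m} z≤n) (nCn≡1 m))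
  count-digitSum≤ (suc k) {m} m<N = trans (∑-digitVecs-suc {k} _) (go N m<N m<N)
    where
    c : ℕ → ℕ → ℕ
    c x m = ∑ (digitVecs b k) (λ as → ⟦ x + digitSum as ℕ.≤? m ⟧)
    -- The range `M` of the first digit is decoupled from `N`: splitting off the value 0 and
    -- lowering both `M` and `m` by one leaves a sum of the same form, and the split is Pascal's
    -- rule.
    go : ∀ M {m} → m < M → m < N → ∑ (allFin M) (λ x → c (toℕ x) m) ≡ suc (k + m) C suc k
    go (suc M) {m} m<M m<N = trans (∑-allFin-suc {M} (λ x → c (toℕ x) m)) (step m m<M m<N)
      where
      step : ∀ m → m < suc M → m < N → c 0 m + ∑ (allFin M) (λ x → c (suc (toℕ x)) m) ≡ suc (k + m) C suc k
      step zero _ m<N = begin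
        c 0 0 + ∑ (allFin M) (λ x → c (suc (toℕ x)) 0)
          ≡⟨ cong₂ _+_ (count-digitSum≤ k m<N) (∑-zero (allFin M) (All.universal (λ x → ∑-zero
                (digitVecs b k) (All.universal (λ as → refl) _)) _)) ⟩
        (k + 0) C k + 0    ≡⟨ ℕ.+-identityʳ _ ⟩
        (k + 0) C k        ≡⟨ cong (_C k) (ℕ.+-identityʳ k) ⟩
        k C k              ≡⟨ trans (nCn≡1 k) (sym (nCn≡1 (suc k))) ⟩
        suc k C suc k      ≡⟨ cong (λ z → suc z C suc k) (ℕ.+-identityʳ k) ⟨
        suc (k + 0) C suc k ∎
      step (suc m) (s≤s m<M) m<N = begin
        c 0 (suc m) + ∑ (allFin M) (λ x → c (suc (toℕ x)) (suc m))
          ≡⟨ cong₂ _+_ (count-digitSum≤ k m<N) (∑-cong (allFin M) (λ x → ∑-cong (digitVecs b k) (λ as →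
               ⟦⟧-⇔ (suc (toℕ x) + digitSum as ℕ.≤? suc m) (toℕ x + digitSum as ℕ.≤? m) ℕ.s≤s⁻¹ s≤s))) ⟩
        (k + suc m) C k + ∑ (allFin M) (λ x → c (toℕ x) m)
          ≡⟨ cong₂ _+_ (cong (_C k) (ℕ.+-suc k m)) (go M m<M (ℕ.<-trans (ℕ.n<1+n m) m<N)) ⟩
        suc (k + m) C k + suc (k + m) C suc k
          ≡⟨ nCk+nC[k+1]≡[n+1]C[k+1] (suc (k + m)) k ⟩
        suc (suc (k + m)) C suc k
          ≡⟨ cong (λ z → suc z C suc k) (ℕ.+-suc k m) ⟨
        suc (k + suc m) C suc k ∎

  -- No carry means `D + b + digitSum as ≤ 2b`, so the digits sum to at most `b - D`. For `D > b`
  -- there is no such vector, and the binomial vanishes because its upper index drops below the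
  -- lower one.
  count-no-carry : ∀ k D → ∑ (digitVecs b (suc k)) (λ as → ⟦ (D + b + digitSum as) / N ℕ.≟ 0 ⟧) ≡ (suc k + b ∸ D) C suc k
  count-no-carry k D with D ℕ.≤? b
  ... | yes D≤b = begin
    ∑ Vs (λ as → ⟦ (D + b + digitSum as) / N ℕ.≟ 0 ⟧)
      ≡⟨ ∑-cong Vs (λ as → ⟦⟧-⇔ ((D + b + digitSum as) / N ℕ.≟ 0) (digitSum as ℕ.≤? b ∸ D) (forth as) (back as)) ⟩
    ∑ Vs (λ as → ⟦ digitSum as ℕ.≤? b ∸ D ⟧)
      ≡⟨ count-digitSum≤ (suc k) (s≤s (ℕ.≤-trans (ℕ.m∸n≤m b D) (ℕ.m≤m+n b _))) ⟩
    (suc k + (b ∸ D)) C suc k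
      ≡⟨ cong (_C suc k) (ℕ.+-∸-assoc (suc k) D≤b) ⟨
    (suc k + b ∸ D) C suc k ∎
    where
    Vs = digitVecs b (suc k)
    rearrange : ∀ z → D + b + z ≡ b + (D + z)
    rearrange z = solve 3 (λ D b z → D :+ b :+ z := b :+ (D :+ z)) refl D b z
    forth : ∀ as → (D + b + digitSum as) / N ≡ 0 → digitSum as ≤ b ∸ D
    forth as eq = subst (_≤ b ∸ D) (ℕ.m+n∸m≡n D _) (ℕ.∸-monoˡ-≤ D (ℕ.+-cancelˡ-≤ b _ _
      (subst₂ _≤_ (rearrange _) (cong (b +_) (ℕ.+-identityʳ b)) (ℕ.s≤s⁻¹ (m/n≡0⇒m<n eq)))))
    back : ∀ as → digitSum as ≤ b ∸ D → (D + b + digitSum as) / N ≡ 0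
    back as le = m<n⇒m/n≡0 (s≤s (subst₂ _≤_ (sym (rearrange _)) (cong (b +_) (sym (ℕ.+-identityʳ b)))
      (ℕ.+-monoʳ-≤ b (subst (D + digitSum as ≤_) (ℕ.m+[n∸m]≡n D≤b) (ℕ.+-monoʳ-≤ D le)))))
  ... | no D≰b = trans
    (∑-zero (digitVecs b (suc k)) (All.universal (λ as → ⟦⟧-no ((D + b + digitSum as) / N ℕ.≟ 0) λ eq →
      ℕ.<-irrefl refl (ℕ.<-≤-trans (m/n≡0⇒m<n {D + b + digitSum as} eq)
        (subst (_≤ D + b + digitSum as) (cong suc (cong (b +_) (sym (ℕ.+-identityʳ b))))
          (ℕ.≤-trans (ℕ.+-monoˡ-≤ b (ℕ.≰⇒> D≰b)) (ℕ.m≤m+n _ _))))) _))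
    (sym (k>n⇒nCk≡0 (s≤s (ℕ.m≤n+o⇒m∸n≤o (suc k + b) D
      (subst (suc k + b ≤_) (ℕ.+-comm k D) (subst (_≤ k + D) (ℕ.+-suc k b) (ℕ.+-monoʳ-≤ k (ℕ.≰⇒> D≰b))))))))

-- Shuffle weights and descent classes

word-injective : ∀ {n} (σ τ : SignedPerm n) → word σ ≡ word τ → σ ≈ τ
word-injective σ τ eq x = trans (sym (act-word σ x)) (trans (cong (λ w → act w x) eq) (act-word τ x))

infix 4 _≈?_
_≈?_ : ∀ {n} (σ τ : SignedPerm n) → Dec (σ ≈ τ)
σ ≈? τ = map′ (word-injective σ τ) (word-cong σ τ) (Vec.≡-dec _≟ᴸ_ (word σ) (word τ))

signedPerms : ∀ n → Enumeration (SignedPerm n)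
signedPerms n = record
  { elements = allSignedPerms n ; _~_ = _≈_
  ; ~-isEquivalence = record
    { refl = λ _ → refl ; sym = λ σ≈τ x → sym (σ≈τ x) ; trans = λ ρ≈σ σ≈τ x → trans (ρ≈σ x) (σ≈τ x) }
  ; _~?_ = _≈?_ ; complete = allSignedPerms-complete ; unique = allSignedPerms-unique n }

⁻¹-cong : ∀ {n} (σ τ : SignedPerm n) → σ ≈ τ → σ ⁻¹ ≈ τ ⁻¹
⁻¹-cong σ τ σ≈τ x = to-injective τ (begin
  to τ (from σ x)   ≡⟨ σ≈τ (from σ x) ⟨
  to σ (from σ x)   ≡⟨ SignedPerm.strictlyInverseˡ σ x ⟩
  x                 ≡⟨ SignedPerm.strictlyInverseˡ τ x ⟨
  to τ (from τ x)   ∎)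

∘≈id⇒ : ∀ {n} (σ τ : SignedPerm n) → σ ∘ₛ τ ≈ idₛ → σ ⁻¹ ≈ τ
∘≈id⇒ σ τ στ≈id x = trans (cong (from σ) (sym (στ≈id x))) (SignedPerm.strictlyInverseʳ σ (to τ x))

⇒∘≈id : ∀ {n} (σ τ : SignedPerm n) → σ ⁻¹ ≈ τ → σ ∘ₛ τ ≈ idₛ
⇒∘≈id σ τ σ⁻¹≈τ x = trans (cong (to σ) (sym (σ⁻¹≈τ x))) (SignedPerm.strictlyInverseˡ σ x)

d≡0⇒id : ∀ {n} (σ : SignedPerm n) → d σ ≡ zero → σ ≈ idₛ
d≡0⇒id σ dσ≡0 = no-descents⇒id σ (trans (sym (toℕ-d σ)) (cong toℕ dσ≡0))

d-id : ∀ {n} → d (idₛ {n}) ≡ zero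
d-id {n} = Fin.toℕ-injective (trans (toℕ-d idₛ) (id-no-descents {n}))

term≤∑ : ∀ {A : Set} (E : Enumeration A) {f : A → ℕ} → Respects E f → ∀ x → f x ≤ ∑ (elements E) f
term≤∑ E {f} f-resp x = subst (_≤ ∑ (elements E) f) (∑-pick E f-resp x)
  (∑-mono-≤ (elements E) (λ y → ⟦⟧*≤ (_~?_ E x y) (f y)))
  where
  ⟦⟧*≤ : ∀ {X : Set} (p : Dec X) m → ⟦ p ⟧ * m ≤ m
  ⟦⟧*≤ (yes _) m = ℕ.≤-reflexive (ℕ.*-identityˡ m)
  ⟦⟧*≤ (no _)  m = z≤n

∑-positive : ∀ {A : Set} (xs : List A) (f : A → ℕ) → 0 < ∑ xs f → ∃ λ x → 0 < f x
∑-positive (x ∷ xs) f lt with f x in eq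
... | suc _ = x , subst (0 <_) (sym eq) (s≤s z≤n)
... | zero  = ∑-positive xs f lt

eulerianᴮ-∑ : ∀ n j → eulerianᴮ n j ≡ ∑ (allSignedPerms n) (λ σ → ⟦ d σ Fin.≟ j ⟧)
eulerianᴮ-∑ n j = begin
  length (filter (λ σ → d σ Fin.≟ j) (allSignedPerms n))
    ≡⟨ ∑-1 (filter (λ σ → d σ Fin.≟ j) (allSignedPerms n)) ⟨
  ∑ (filter (λ σ → d σ Fin.≟ j) (allSignedPerms n)) (λ _ → 1)
    ≡⟨ ∑-filter (λ σ → d σ Fin.≟ j) (allSignedPerms n) (λ _ → 1) ⟩
  ∑ (allSignedPerms n) (λ σ → ⟦ d σ Fin.≟ j ⟧ * 1)
    ≡⟨ ∑-cong (allSignedPerms n) (λ σ → ℕ.*-identityʳ _) ⟩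
  ∑ (allSignedPerms n) (λ σ → ⟦ d σ Fin.≟ j ⟧)                ∎

module Shuffles (b : ℕ) where

  open DigitSorting b
  open Carries b

  -- The numerator of `Q b` at the inverse of `σ`; inverting here removes the inverse from the
  -- descent count.
  weight : ∀ {n} → SignedPerm n → ℕ
  weight {n} σ = (n + b ∸ toℕ (d σ)) C n

  module _ {k : ℕ} where

    private
      n = suc k
      Vs = digitVecs b n
      Gs = allSignedPerms n

    weight-sorters : (ω : SignedPerm n) → weight ω ≡ ∑ Vs (λ h → ⟦ sorter h ∘ₛ ω ≈? idₛ ⟧)
    weight-sorters ω = begin
      (n + b ∸ toℕ (d ω)) C n
        ≡⟨ cong (λ m → (n + b ∸ m) C n) (toℕ-d ω) ⟩
      (n + b ∸ descents (word ω)) C n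
        ≡⟨ count-no-carry k (descents (word ω)) ⟨
      ∑ Vs (λ as → ⟦ (descents (word ω) + b + digitSum as) / suc (2 * b) ℕ.≟ 0 ⟧)
        ≡⟨ ∑-descents-sorter ω (λ m → ⟦ m ℕ.≟ 0 ⟧) ⟨
      ∑ Vs (λ h → ⟦ descents (word (sorter h ∘ₛ ω)) ℕ.≟ 0 ⟧)
        ≡⟨ ∑-cong Vs (λ h → ⟦⟧-⇔ (descents (word (sorter h ∘ₛ ω)) ℕ.≟ 0) (sorter h ∘ₛ ω ≈? idₛ)
             (no-descents⇒id (sorter h ∘ₛ ω))
             (λ eq → trans (cong descents (word-cong (sorter h ∘ₛ ω) idₛ eq)) (id-no-descents {n}))) ⟩
      ∑ Vs (λ h → ⟦ sorter h ∘ₛ ω ≈? idₛ ⟧) ∎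

    sorter-carries : ∀ (ρ : SignedPerm n) i →
      ∑ Vs (λ h → ⟦ d (sorter h ∘ₛ ρ) Fin.≟ i ⟧) ≡ ∑ Vs (λ as → ⟦ carryStep b (d ρ) as Fin.≟ i ⟧)
    sorter-carries ρ i = begin
      ∑ Vs (λ h → ⟦ d (sorter h ∘ₛ ρ) Fin.≟ i ⟧)
        ≡⟨ ∑-cong Vs (λ h → toℕ-≟ (d (sorter h ∘ₛ ρ)) (toℕ-d (sorter h ∘ₛ ρ))) ⟩
      ∑ Vs (λ h → ⟦ descents (word (sorter h ∘ₛ ρ)) ℕ.≟ toℕ i ⟧)
        ≡⟨ ∑-descents-sorter ρ (λ m → ⟦ m ℕ.≟ toℕ i ⟧) ⟩
      ∑ Vs (λ as → ⟦ (descents (word ρ) + b + digitSum as) / suc (2 * b) ℕ.≟ toℕ i ⟧)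
        ≡⟨ ∑-cong Vs (λ as → toℕ-≟ (carryStep b (d ρ) as)
             (trans (Fin.toℕ-fromℕ< (newCarry< b (d ρ) as))
               (cong (λ m → (m + b + digitSum as) / suc (2 * b)) (toℕ-d ρ)))) ⟨
      ∑ Vs (λ as → ⟦ carryStep b (d ρ) as Fin.≟ i ⟧) ∎
      where
      toℕ-≟ : ∀ j {m} → toℕ j ≡ m → ⟦ j Fin.≟ i ⟧ ≡ ⟦ m ℕ.≟ toℕ i ⟧
      toℕ-≟ j refl = ⟦⟧-⇔ (j Fin.≟ i) (toℕ j ℕ.≟ toℕ i) (cong toℕ) Fin.toℕ-injective

    -- Each digit vector `h` contributes at a single `τ`, the inverse of `sorter h ∘ₛ ρ`, and there
    -- the class condition on `τ ⁻¹` becomes a condition on the descents of `sorter h ∘ₛ ρ`.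
    ∑-weight-class : ∀ (ρ : SignedPerm n) i →
      ∑ Gs (λ τ → ⟦ d (τ ⁻¹) Fin.≟ i ⟧ * weight (ρ ∘ₛ τ)) ≡ ∑ Vs (λ as → ⟦ carryStep b (d ρ) as Fin.≟ i ⟧)
    ∑-weight-class ρ i = begin
      ∑ Gs (λ τ → ⟦ d (τ ⁻¹) Fin.≟ i ⟧ * weight (ρ ∘ₛ τ))
        ≡⟨ ∑-cong Gs (λ τ → trans (cong (⟦ d (τ ⁻¹) Fin.≟ i ⟧ *_) (weight-sorters (ρ ∘ₛ τ)))
             (sym (∑-*ˡ Vs ⟦ d (τ ⁻¹) Fin.≟ i ⟧ _))) ⟩
      ∑ Gs (λ τ → ∑ Vs (λ h → ⟦ d (τ ⁻¹) Fin.≟ i ⟧ * ⟦ sorter h ∘ₛ ρ ∘ₛ τ ≈? idₛ ⟧))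
        ≡⟨ ∑-swap Gs Vs _ ⟩
      ∑ Vs (λ h → ∑ Gs (λ τ → ⟦ d (τ ⁻¹) Fin.≟ i ⟧ * ⟦ sorter h ∘ₛ ρ ∘ₛ τ ≈? idₛ ⟧))
        ≡⟨ ∑-cong Vs (λ h → ∑-cong Gs (λ τ → trans (ℕ.*-comm ⟦ d (τ ⁻¹) Fin.≟ i ⟧ _)
             (cong (_* ⟦ d (τ ⁻¹) Fin.≟ i ⟧) (⟦⟧-⇔ (sorter h ∘ₛ ρ ∘ₛ τ ≈? idₛ) ((sorter h ∘ₛ ρ) ⁻¹ ≈? τ)
               (∘≈id⇒ (sorter h ∘ₛ ρ) τ) (⇒∘≈id (sorter h ∘ₛ ρ) τ))))) ⟩
      ∑ Vs (λ h → ∑ Gs (λ τ → ⟦ (sorter h ∘ₛ ρ) ⁻¹ ≈? τ ⟧ * ⟦ d (τ ⁻¹) Fin.≟ i ⟧))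
        ≡⟨ ∑-cong Vs (λ h → ∑-pick (signedPerms n)
             (λ {σ} {τ} σ≈τ → cong (λ j → ⟦ j Fin.≟ i ⟧) (d-cong (σ ⁻¹) (τ ⁻¹) (⁻¹-cong σ τ σ≈τ))) ((sorter h ∘ₛ ρ) ⁻¹)) ⟩
      ∑ Vs (λ h → ⟦ d (sorter h ∘ₛ ρ) Fin.≟ i ⟧)
        ≡⟨ sorter-carries ρ i ⟩
      ∑ Vs (λ as → ⟦ carryStep b (d ρ) as Fin.≟ i ⟧) ∎

    ∑-weight : ∑ Gs (λ μ → weight (μ ⁻¹)) ≡ ∑ Vs (λ _ → 1)
    ∑-weight = begin
      ∑ Gs (λ μ → weight (μ ⁻¹))
        ≡⟨ ∑-cong Gs (λ μ → weight-sorters (μ ⁻¹)) ⟩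
      ∑ Gs (λ μ → ∑ Vs (λ h → ⟦ sorter h ∘ₛ μ ⁻¹ ≈? idₛ ⟧))
        ≡⟨ ∑-swap Gs Vs _ ⟩
      ∑ Vs (λ h → ∑ Gs (λ μ → ⟦ sorter h ∘ₛ μ ⁻¹ ≈? idₛ ⟧))
        ≡⟨ ∑-cong Vs (λ h → ∑-cong Gs (λ μ → ⟦⟧-⇔ (sorter h ∘ₛ μ ⁻¹ ≈? idₛ) (sorter h ≈? μ)
             (λ eq → ⁻¹-cong (sorter h ⁻¹) (μ ⁻¹) (∘≈id⇒ (sorter h) (μ ⁻¹) eq))
             (λ eq → ⇒∘≈id (sorter h) (μ ⁻¹) (⁻¹-cong (sorter h) μ eq)))) ⟩
      ∑ Vs (λ h → ∑ Gs (λ μ → ⟦ sorter h ≈? μ ⟧))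
        ≡⟨ ∑-cong Vs (λ h → ∑-pick-1 (signedPerms n) (sorter h)) ⟩
      ∑ Vs (λ _ → 1) ∎

-- With b = n, the digit vectors with j digits 2b send the carry 0 to j.
eulerianᴮ-positive : ∀ k (j : State (suc k)) → 0 < eulerianᴮ (suc k) j
eulerianᴮ-positive k j = ℕ.≤-trans (positive (∑-positive Vs _ hit)) (ℕ.≤-reflexive (sym (eulerianᴮ-∑ n j)))
  where
  n = suc k
  b = n
  N = suc (2 * b)
  open DigitSorting b
  open Carries b
  open Shuffles b
  Vs = digitVecs b n

  saturated : ∀ {m} i → i ≤ m → ∃ λ (as : Vec (Digit b) m) → digitSum as ≡ i * (2 * b)
  saturated {zero}  zero    _ = [] , refl
  saturated {suc m} zero    _ with as , eq ← saturated {m} zero z≤n = zero ∷ as , eq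
  saturated {suc m} (suc i) (s≤s i≤m) with as , eq ← saturated {m} i i≤m =
    fromℕ (2 * b) ∷ as , cong₂ _+_ (Fin.toℕ-fromℕ (2 * b)) eq

  i = toℕ j
  i≤n : i ≤ n
  i≤n = Fin.toℕ≤pred[n] j
  as = proj₁ (saturated i i≤n)

  carry : carryStep b (d (idₛ {n})) as ≡ j
  carry = Fin.toℕ-injective (begin
    toℕ (carryStep b (d (idₛ {n})) as)    ≡⟨ Fin.toℕ-fromℕ< (newCarry< b (d (idₛ {n})) as) ⟩
    (toℕ (d (idₛ {n})) + b + digitSum as) / N
      ≡⟨ cong₂ (λ x y → (toℕ x + b + y) / N) (d-id {n}) (proj₂ (saturated i i≤n)) ⟩
    (b + i * (2 * b)) / N                 ≡⟨ cong (λ x → (x + i * (2 * b)) / N) (ℕ.m+[n∸m]≡n i≤n) ⟨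
    (i + (b ∸ i) + i * (2 * b)) / N
      -- The quotient is exactly `i` only if `b - i` is a genuine remainder, that is `i ≤ b`;
      -- `b = n` achieves this for every state at once.
      ≡⟨ cong (_/ N) (solve 3 (λ i r b → i :+ r :+ i :* (con 2 :* b) := i :*
            (con 1 :+ con 2 :* b) :+ r) refl i (b ∸ i) b) ⟩
    (i * N + (b ∸ i)) / N                 ≡⟨ borrow-carry i (b ∸ i) ⟨
    i + (b ∸ i) / N
      ≡⟨ cong (i +_) (m<n⇒m/n≡0 (s≤s (ℕ.≤-trans (ℕ.m∸n≤m b i) (ℕ.m≤m+n b _)))) ⟩
    i + 0                                 ≡⟨ ℕ.+-identityʳ i ⟩
    i                                     ∎)

  hit : 0 < ∑ Vs (λ h → ⟦ d (sorter h ∘ₛ idₛ) Fin.≟ j ⟧)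
  hit = subst (0 <_) (sym (sorter-carries idₛ j))
    (ℕ.≤-trans (ℕ.≤-reflexive (sym (⟦⟧-yes (carryStep b (d (idₛ {n})) as Fin.≟ j) carry)))
      (term≤∑ (digitVecsᴱ n) (cong (λ v → ⟦ carryStep b (d (idₛ {n})) v Fin.≟ j ⟧)) as))

  positive : ∃ (λ h → 0 < ⟦ d (sorter h ∘ₛ idₛ) Fin.≟ j ⟧) → 0 < ∑ (allSignedPerms n) (λ σ → ⟦ d σ Fin.≟ j ⟧)
  positive (h , lt) = ℕ.<-≤-trans lt
    (term≤∑ (signedPerms n) (λ {σ} {τ} eq → cong (λ x → ⟦ x Fin.≟ j ⟧) (d-cong σ τ eq)) (sorter h ∘ₛ idₛ))

-- The order of the hyperoctahedral group

module _ {n : ℕ} where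

  private
    Ls : List (Letter n)
    Ls = allLetters n

    words : ∀ k → List (Vec (Letter n) k)
    words = allVecs Ls

  Fresh : Letter n → ∀ {k} → Vec (Letter n) k → Set
  Fresh x w = Allᵛ.All (λ j → proj₂ x ≢ j) (Vec.map proj₂ w)

  fresh? : ∀ x {k} (w : Vec (Letter n) k) → Dec (Fresh x w)
  fresh? x w = Allᵛ.all? (λ j → ¬? (proj₂ x Fin.≟ j)) (Vec.map proj₂ w)

  Distinct : ∀ {k} → Vec (Letter n) k → Set
  Distinct w = Uniqueᵛ (Vec.map proj₂ w)

  distinct? : ∀ {k} (w : Vec (Letter n) k) → Dec (Distinct w)
  distinct? w = allPairs? (λ i j → ¬? (i Fin.≟ j)) (Vec.map proj₂ w)

  same-index : ∀ (x y : Letter n) → proj₂ x ≡ proj₂ y → ⟦ y ≟ᴸ x ⟧ + ⟦ neg y ≟ᴸ x ⟧ ≡ 1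
  same-index (Sign.+ , i) (Sign.+ , i) refl rewrite ⟦⟧-yes ((Sign.+ , i) ≟ᴸ (Sign.+ , i)) refl = refl
  same-index (Sign.+ , i) (Sign.- , i) refl rewrite ⟦⟧-yes ((Sign.+ , i) ≟ᴸ (Sign.+ , i)) refl = refl
  same-index (Sign.- , i) (Sign.+ , i) refl rewrite ⟦⟧-yes ((Sign.- , i) ≟ᴸ (Sign.- , i)) refl = refl
  same-index (Sign.- , i) (Sign.- , i) refl rewrite ⟦⟧-yes ((Sign.- , i) ≟ᴸ (Sign.- , i)) refl = refl

  fresh-∷ : ∀ x y {k} (w : Vec (Letter n) k) → Fresh y w →
    ⟦ fresh? x (y ∷ w) ⟧ + (⟦ y ≟ᴸ x ⟧ + ⟦ neg y ≟ᴸ x ⟧) ≡ ⟦ fresh? x w ⟧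
  fresh-∷ x y w y∉w with proj₂ x Fin.≟ proj₂ y
  ... | yes eq = trans (same-index x y eq) (sym (⟦⟧-yes (fresh? x w) (subst (λ i → Allᵛ.All (i ≢_)
        (Vec.map proj₂ w)) (sym eq) y∉w)))
  ... | no neq rewrite ⟦⟧-no (y ≟ᴸ x) (λ { refl → neq refl }) | ⟦⟧-no (neg y ≟ᴸ x)
        (λ { refl → neq refl }) = ℕ.+-identityʳ _

  -- Every letter of `w` excludes two letters, itself and its opposite, and distinct indices keep
  -- these pairs disjoint.
  count-fresh : ∀ {k} (w : Vec (Letter n) k) → Distinct w → ∑ Ls (λ x → ⟦ fresh? x w ⟧) + k * 2 ≡ n * 2
  count-fresh [] _ = trans (ℕ.+-identityʳ _) (trans (allLetters-length n) (solve 1 (λ n → n :+ n := n :* con 2) refl n))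
  count-fresh {suc k} (y ∷ w) (y∉w ∷ w!) = begin
    ∑ Ls (λ x → ⟦ fresh? x (y ∷ w) ⟧) + (2 + k * 2)
      ≡⟨ ℕ.+-assoc _ 2 (k * 2) ⟨
    ∑ Ls (λ x → ⟦ fresh? x (y ∷ w) ⟧) + 2 + k * 2
      ≡⟨ cong (λ z → ∑ Ls (λ x → ⟦ fresh? x (y ∷ w) ⟧) + z + k * 2)
           (cong₂ _+_ (∑-pick-1 (letters n) y) (∑-pick-1 (letters n) (neg y))) ⟨
    ∑ Ls (λ x → ⟦ fresh? x (y ∷ w) ⟧) + (∑ Ls (λ x → ⟦ y ≟ᴸ x ⟧) + ∑ Ls (λ x → ⟦ neg y ≟ᴸ x ⟧)) + k * 2
      ≡⟨ cong (λ z → ∑ Ls (λ x → ⟦ fresh? x (y ∷ w) ⟧) + z + k * 2) (∑-+ Ls _ _) ⟨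
    ∑ Ls (λ x → ⟦ fresh? x (y ∷ w) ⟧) + ∑ Ls (λ x → ⟦ y ≟ᴸ x ⟧ + ⟦ neg y ≟ᴸ x ⟧) + k * 2
      ≡⟨ cong (_+ k * 2) (∑-+ Ls _ _) ⟨
    ∑ Ls (λ x → ⟦ fresh? x (y ∷ w) ⟧ + (⟦ y ≟ᴸ x ⟧ + ⟦ neg y ≟ᴸ x ⟧)) + k * 2
      ≡⟨ cong (_+ k * 2) (∑-cong Ls (λ x → fresh-∷ x y w y∉w)) ⟩
    ∑ Ls (λ x → ⟦ fresh? x w ⟧) + k * 2
      ≡⟨ count-fresh w w! ⟩
    n * 2 ∎

  count-distinct : ∀ k m → m + k ≡ n → m ! * ∑ (words k) (λ w → ⟦ distinct? w ⟧) ≡ 2 ^ k * n !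
  count-distinct zero    m eq = trans (ℕ.*-identityʳ (m !))
    (trans (cong _! (trans (sym (ℕ.+-identityʳ m)) eq)) (sym (ℕ.*-identityˡ (n !))))
  count-distinct (suc k) m eq = begin
    m ! * ∑ (words (suc k)) (λ w → ⟦ distinct? w ⟧)
      ≡⟨ cong (m ! *_) (begin
        ∑ (words (suc k)) (λ w → ⟦ distinct? w ⟧)
          ≡⟨ ∑-cartesianProductWith _∷_ Ls (words k) _ ⟩
        ∑ Ls (λ x → ∑ (words k) (λ w → ⟦ distinct? (x ∷ w) ⟧))
          ≡⟨ ∑-swap Ls (words k) _ ⟩
        ∑ (words k) (λ w → ∑ Ls (λ x → ⟦ distinct? (x ∷ w) ⟧))
          ≡⟨ ∑-cong (words k) (λ w → trans (∑-cong Ls (λ x → trans (⟦⟧-× (fresh? x w)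
                (distinct? w)) (ℕ.*-comm ⟦ fresh? x w ⟧ _)))
               (∑-*ˡ Ls ⟦ distinct? w ⟧ _)) ⟩
        ∑ (words k) (λ w → ⟦ distinct? w ⟧ * ∑ Ls (λ x → ⟦ fresh? x w ⟧))
          ≡⟨ ∑-cong (words k) (λ w → ⟦⟧-guard (distinct? w) (λ w! → ℕ.+-cancelʳ-≡ (k * 2) _
                (suc m * 2) (trans (count-fresh w w!) 2n≡))) ⟩
        ∑ (words k) (λ w → ⟦ distinct? w ⟧ * (suc m * 2))
          ≡⟨ ∑-*ʳ (words k) (suc m * 2) _ ⟩
        ∑ (words k) (λ w → ⟦ distinct? w ⟧) * (suc m * 2) ∎) ⟩
    m ! * (∑ (words k) (λ w → ⟦ distinct? w ⟧) * (suc m * 2))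
      ≡⟨ solve 3 (λ f c m → f :* (c :* ((con 1 :+ m) :* con 2)) := con 2 :* ((con 1 :+ m) :* f :* c)) refl
           (m !) (∑ (words k) (λ w → ⟦ distinct? w ⟧)) m ⟩
    2 * (suc m ! * ∑ (words k) (λ w → ⟦ distinct? w ⟧))
      ≡⟨ cong (2 *_) (count-distinct k (suc m) (trans (sym (ℕ.+-suc m k)) eq)) ⟩
    2 * (2 ^ k * n !)
      ≡⟨ ℕ.*-assoc 2 (2 ^ k) (n !) ⟨
    2 ^ suc k * n ! ∎
    where
    2n≡ : n * 2 ≡ suc m * 2 + k * 2
    2n≡ = trans (cong (_* 2) (trans (sym eq) (ℕ.+-suc m k))) (ℕ.*-distribʳ-+ 2 (suc m) k)

  word-distinct : ∀ σ → Distinct (word σ)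
  word-distinct σ = subst Uniqueᵛ (Vec.tabulate-∘ proj₂ (to σ ∘ pos)) (Uniqueᵛ.tabulate⁺ λ {i} {j} → index-injective i j)
    where
    index-injective : ∀ i j → proj₂ (to σ (pos i)) ≡ proj₂ (to σ (pos j)) → i ≡ j
    index-injective i j eq with to σ (pos j) ≟ᴸ to σ (pos i)
    ... | yes e = sym (cong proj₂ (to-injective σ e))
    ... | no ne = sym (cong proj₂ (to-injective σ (trans (SignedPerm.odd σ (pos j))
          (opposite-letter (to σ (pos i)) (to σ (pos j)) eq ne))))
      where
      opposite-letter : ∀ (x y : Letter n) → proj₂ x ≡ proj₂ y → y ≢ x → neg y ≡ x
      opposite-letter (Sign.+ , _) (Sign.+ , _) refl y≢x = contradiction refl y≢x
      opposite-letter (Sign.+ , _) (Sign.- , _) refl y≢x = refl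
      opposite-letter (Sign.- , _) (Sign.+ , _) refl y≢x = refl
      opposite-letter (Sign.- , _) (Sign.- , _) refl y≢x = contradiction refl y≢x

  act-injective : ∀ (w : Vec (Letter n) n) → Distinct w → ∀ {x y} → act w x ≡ act w y → x ≡ y
  act-injective w w! {s , i} {t , j} eq with Uniqueᵛ.lookup-injective w! i j
    (trans (Vec.lookup-map i proj₂ w) (trans (cong proj₂ eq) (sym (Vec.lookup-map j proj₂ w))))
  ... | refl = cong (_, i) (Sign.*-cancelʳ-≡ (proj₁ (lookup w i)) s t (cong proj₁ eq))

  -- A word with distinct indices acts injectively on the letters, so `fromInjective` realises it by
  -- a signed permutation, unique up to `_≈_`. This reduces the order of the group to counting
  -- words.
  word-fibre : ∀ w → ∑ (allSignedPerms n) (λ σ → ⟦ Vec.≡-dec _≟ᴸ_ (word σ) w ⟧) ≡ ⟦ distinct? w ⟧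
  word-fibre w with distinct? w
  ... | yes w! = trans
    (∑-cong (allSignedPerms n) (λ σ → ⟦⟧-⇔ (Vec.≡-dec _≟ᴸ_ (word σ) w) (σ₀ ≈? σ)
      (λ eq → word-injective σ₀ σ (trans word-σ₀ (sym eq))) (λ eq → trans (sym (word-cong σ₀ σ eq)) word-σ₀)))
    (∑-pick-1 (signedPerms n) σ₀)
    where
    σ₀ : SignedPerm n
    σ₀ = fromInjective (act w) (act-injective w w!) (act-odd w)
    word-σ₀ : word σ₀ ≡ w
    word-σ₀ = Vec.tabulate∘lookup w
  ... | no ¬w! = ∑-zero (allSignedPerms n) (All.universal (λ σ → ⟦⟧-no (Vec.≡-dec _≟ᴸ_ (word σ) w)
    (λ eq → ¬w! (subst Distinct eq (word-distinct σ)))) _)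

  signedPerms-count : ∑ (allSignedPerms n) (λ _ → 1) ≡ 2 ^ n * n !
  signedPerms-count = begin
    ∑ (allSignedPerms n) (λ _ → 1)
      ≡⟨ ∑-cong (allSignedPerms n) (λ σ → ∑-pick-1 (vecs _≟ᴸ_ ∈-allLetters (allLetters-unique n) n) (word σ)) ⟨
    ∑ (allSignedPerms n) (λ σ → ∑ (words n) (λ w → ⟦ Vec.≡-dec _≟ᴸ_ (word σ) w ⟧))
      ≡⟨ ∑-swap (allSignedPerms n) (words n) _ ⟩
    ∑ (words n) (λ w → ∑ (allSignedPerms n) (λ σ → ⟦ Vec.≡-dec _≟ᴸ_ (word σ) w ⟧))
      ≡⟨ ∑-cong (words n) word-fibre ⟩
    ∑ (words n) (λ w → ⟦ distinct? w ⟧)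
      ≡⟨ ℕ.*-identityˡ _ ⟨
    0 ! * ∑ (words n) (λ w → ⟦ distinct? w ⟧)
      ≡⟨ count-distinct n 0 refl ⟩
    2 ^ n * n ! ∎

∑-eulerianᴮ : ∀ n → ∑ (allFin (suc n)) (eulerianᴮ n) ≡ 2 ^ n * n !
∑-eulerianᴮ n = begin
  ∑ (allFin (suc n)) (eulerianᴮ n)
    ≡⟨ ∑-cong (allFin (suc n)) (eulerianᴮ-∑ n) ⟩
  ∑ (allFin (suc n)) (λ j → ∑ (allSignedPerms n) (λ σ → ⟦ d σ Fin.≟ j ⟧))
    ≡⟨ ∑-swap (allFin (suc n)) (allSignedPerms n) _ ⟩
  ∑ (allSignedPerms n) (λ σ → ∑ (allFin (suc n)) (λ j → ⟦ d σ Fin.≟ j ⟧))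
    ≡⟨ ∑-cong (allSignedPerms n) (λ σ → ∑-pick-1 (fins (suc n)) (d σ)) ⟩
  ∑ (allSignedPerms n) (λ _ → 1)
    ≡⟨ signedPerms-count {n} ⟩
  2 ^ n * n ! ∎

open Summation (IsCommutativeRing.isCommutativeSemiring ℚ.+-*-isCommutativeRing)
  using () renaming
  ( ⟦_⟧ to ⟪_⟫; ⟦⟧-yes to ⟪⟫-yes; ⟦⟧-⇔ to ⟪⟫-⇔; ⟦⟧-× to ⟪⟫-×; ⟦⟧-guard to ⟪⟫-guard
  ; ∑-cong to sum-cong; ∑-*ˡ to sum-*ˡ; ∑-*ʳ to sum-*ʳ; ∑-swap to sum-swap
  ; ∑-cartesianProductWith to sum-cartesianProductWith; ∑-filter to sum-filter
  ; ∑-pick to sum-pick; ∑-pick-1 to sum-pick-1; ∑-reindex to sum-reindex)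

-- Shuffle and carries probabilities

fromℚᵘ-+ : ∀ p q → fromℚᵘ p ℚ.+ fromℚᵘ q ≡ fromℚᵘ (p ℚᵘ.+ q)
fromℚᵘ-+ p q = ℚ.toℚᵘ-injective (ℚᵘ.≃-trans (ℚ.toℚᵘ-homo-+ (fromℚᵘ p) (fromℚᵘ q))
  (ℚᵘ.≃-trans (ℚᵘ.+-cong (ℚ.toℚᵘ-fromℚᵘ p) (ℚ.toℚᵘ-fromℚᵘ q)) (ℚᵘ.≃-sym (ℚ.toℚᵘ-fromℚᵘ (p ℚᵘ.+ q)))))

fromℚᵘ-* : ∀ p q → fromℚᵘ p ℚ.* fromℚᵘ q ≡ fromℚᵘ (p ℚᵘ.* q)
fromℚᵘ-* p q = ℚ.toℚᵘ-injective (ℚᵘ.≃-trans (ℚ.toℚᵘ-homo-* (fromℚᵘ p) (fromℚᵘ q))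
  (ℚᵘ.≃-trans (ℚᵘ.*-cong (ℚ.toℚᵘ-fromℚᵘ p) (ℚ.toℚᵘ-fromℚᵘ q)) (ℚᵘ.≃-sym (ℚ.toℚᵘ-fromℚᵘ (p ℚᵘ.* q)))))

-- Abstract so that the normalising arithmetic of ℚ never unfolds.
abstract
  ι : ℕ → ℚ
  ι m = ℤ.+ m ℚ./ 1

  ι-0 : ι 0 ≡ 0ℚ
  ι-0 = refl

  ι-1 : ι 1 ≡ 1ℚ
  ι-1 = refl

  ι-+ : ∀ a b → ι (a ℕ.+ b) ≡ ι a ℚ.+ ι b
  ι-+ a b = sym (trans (fromℚᵘ-+ (mkℚᵘ (ℤ.+ a) 0) (mkℚᵘ (ℤ.+ b) 0)) (ℚ.fromℚᵘ-cong {mkℚᵘ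
        (ℤ.+ a) 0 ℚᵘ.+ mkℚᵘ (ℤ.+ b) 0} {mkℚᵘ (ℤ.+ (a ℕ.+ b)) 0}
    (*≡* (cong (ℤ._* ℤ.+ 1) (cong₂ ℤ._+_ (ℤ.*-identityʳ (ℤ.+ a)) (ℤ.*-identityʳ (ℤ.+ b)))))))

  ι-* : ∀ a b → ι (a ℕ.* b) ≡ ι a ℚ.* ι b
  ι-* a b = sym (trans (fromℚᵘ-* (mkℚᵘ (ℤ.+ a) 0) (mkℚᵘ (ℤ.+ b) 0)) (ℚ.fromℚᵘ-cong {mkℚᵘ
        (ℤ.+ a) 0 ℚᵘ.* mkℚᵘ (ℤ.+ b) 0} {mkℚᵘ (ℤ.+ (a ℕ.* b)) 0}
    (*≡* (cong (ℤ._* ℤ.+ 1) (sym (ℤ.pos-* a b))))))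

  ratio : ∀ w m .{{_ : ℕ.NonZero m}} → ℤ.+ w ℚ./ m ≡ ι w ℚ.* (ℤ.+ 1 ℚ./ m)
  ratio w (suc m) = sym (trans (fromℚᵘ-* (mkℚᵘ (ℤ.+ w) 0) (mkℚᵘ (ℤ.+ 1) m)) (ℚ.fromℚᵘ-cong {mkℚᵘ
        (ℤ.+ w) 0 ℚᵘ.* mkℚᵘ (ℤ.+ 1) m} {mkℚᵘ (ℤ.+ w) m}
    (*≡* (cong₂ ℤ._*_ (ℤ.*-identityʳ (ℤ.+ w)) (sym (cong (λ z → ℤ.+ suc z) (ℕ.+-identityʳ m)))))))

  unit-fraction : ∀ m .{{_ : ℕ.NonZero m}} → ι m ℚ.* (ℤ.+ 1 ℚ./ m) ≡ 1ℚ
  unit-fraction (suc m) = trans (fromℚᵘ-* (mkℚᵘ (ℤ.+ suc m) 0) (mkℚᵘ (ℤ.+ 1) m))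
        (ℚ.fromℚᵘ-cong {mkℚᵘ (ℤ.+ suc m) 0 ℚᵘ.* mkℚᵘ (ℤ.+ 1) m} {mkℚᵘ (ℤ.+ 1) 0}
    (*≡* (trans (ℤ.*-identityʳ _) (trans (ℤ.*-identityʳ _) (sym (trans (ℤ.*-identityˡ _) (cong
          (λ z → ℤ.+ suc z) (ℕ.+-identityʳ m))))))))

*-rotate : ∀ x y z → x ℚ.* (y ℚ.* z) ≡ y ℚ.* (x ℚ.* z)
*-rotate x y z = trans (sym (ℚ.*-assoc x y z)) (trans (cong (ℚ._* z) (ℚ.*-comm x y)) (ℚ.*-assoc y x z))

ι-⟦⟧ : ∀ {X : Set} (p : Dec X) → ι ⟦ p ⟧ ≡ ⟪ p ⟫
ι-⟦⟧ (yes _) = ι-1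
ι-⟦⟧ (no _)  = ι-0

ι-∑ : ∀ {A : Set} (xs : List A) (f : A → ℕ) → ι (∑ xs f) ≡ sumOver xs (ι ∘ f)
ι-∑ []       f = ι-0
ι-∑ (x ∷ xs) f = trans (ι-+ (f x) (∑ xs f)) (cong (λ z → ι (f x) ℚ.+ z) (ι-∑ xs f))

digitVecs-count : ∀ b k → ∑ (digitVecs b k) (λ _ → 1) ≡ suc (2 ℕ.* b) ^ k
digitVecs-count b zero    = refl
digitVecs-count b (suc k) = begin
  ∑ (digitVecs b (suc k)) (λ _ → 1)
    ≡⟨ Carries.∑-digitVecs-suc b {k} (λ _ → 1) ⟩
  ∑ (allFin N) (λ _ → ∑ (digitVecs b k) (λ _ → 1))
    ≡⟨ Sumℕ.∑-cong (allFin N) (λ _ → trans (digitVecs-count b k) (sym (ℕ.*-identityˡ _))) ⟩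
  ∑ (allFin N) (λ _ → 1 ℕ.* N ^ k)
    ≡⟨ Sumℕ.∑-*ʳ (allFin N) (N ^ k) (λ _ → 1) ⟩
  ∑ (allFin N) (λ _ → 1) ℕ.* N ^ k                               ≡⟨ cong (ℕ._* N ^ k) (allFin-length N) ⟩
  N ℕ.* N ^ k                                                    ∎
  where N = suc (2 ℕ.* b)

module Probabilities (k b : ℕ) where

  open Shuffles b

  n N : ℕ
  n = suc k
  N = suc (2 ℕ.* b)

  Gs : List (SignedPerm n)
  Gs = allSignedPerms n

  Ss : List (State n)
  Ss = allFin (suc n)

  -- The inverse of `N ^ r`, in the recursive form in which `iid` multiplies masses.
  κ : ℕ → ℚ
  κ zero    = 1ℚ
  κ (suc r) = ℤ.+ 1 ℚ./ N ℚ.* κ r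

  mass-κ : ∀ {r} (as : Vec (Digit b) r) → mass (iid (uniformDigit b) r) as ≡ κ r
  mass-κ []       = refl
  mass-κ (a ∷ as) = cong (ℤ.+ 1 ℚ./ N ℚ.*_) (mass-κ as)

  κ-unit : ∀ r → ι (N ^ r) ℚ.* κ r ≡ 1ℚ
  κ-unit zero    = trans (ℚ.*-identityʳ _) ι-1
  κ-unit (suc r) = begin
    ι (N ℕ.* N ^ r) ℚ.* (ℤ.+ 1 ℚ./ N ℚ.* κ r)
      ≡⟨ cong (ℚ._* (ℤ.+ 1 ℚ./ N ℚ.* κ r)) (ι-* N (N ^ r)) ⟩
    ι N ℚ.* ι (N ^ r) ℚ.* (ℤ.+ 1 ℚ./ N ℚ.* κ r)        ≡⟨ ℚ.*-assoc (ι N) (ι (N ^ r)) _ ⟩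
    ι N ℚ.* (ι (N ^ r) ℚ.* (ℤ.+ 1 ℚ./ N ℚ.* κ r))
      ≡⟨ cong (ι N ℚ.*_) (*-rotate (ι (N ^ r)) (ℤ.+ 1 ℚ./ N) (κ r)) ⟩
    ι N ℚ.* (ℤ.+ 1 ℚ./ N ℚ.* (ι (N ^ r) ℚ.* κ r))
      ≡⟨ cong (λ x → ι N ℚ.* (ℤ.+ 1 ℚ./ N ℚ.* x)) (κ-unit r) ⟩
    ι N ℚ.* (ℤ.+ 1 ℚ./ N ℚ.* 1ℚ)                     ≡⟨ cong (ι N ℚ.*_) (ℚ.*-identityʳ _) ⟩
    ι N ℚ.* (ℤ.+ 1 ℚ./ N)                          ≡⟨ unit-fraction N ⟩
    1ℚ                                       ∎

  P-count : ∀ i j → P n b i j ≡ ι (∑ (digitVecs b n) (λ as → ⟦ carryStep b i as Fin.≟ j ⟧)) ℚ.* κ n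
  P-count i j = begin
    P n b i j
      ≡⟨ sum-filter (λ as → carryStep b i as Fin.≟ j) (digitVecs b n) _ ⟩
    sumOver (digitVecs b n) (λ as → ⟪ carryStep b i as Fin.≟ j ⟫ ℚ.* mass (iid (uniformDigit b) n) as)
      ≡⟨ sum-cong (digitVecs b n) (λ as → cong₂ ℚ._*_ (sym (ι-⟦⟧ (carryStep b i as Fin.≟ j))) (mass-κ as)) ⟩
    sumOver (digitVecs b n) (λ as → ι ⟦ carryStep b i as Fin.≟ j ⟧ ℚ.* κ n)
      ≡⟨ sum-*ʳ (digitVecs b n) (κ n) (λ as → ι ⟦ carryStep b i as Fin.≟ j ⟧) ⟩
    sumOver (digitVecs b n) (λ as → ι ⟦ carryStep b i as Fin.≟ j ⟧) ℚ.* κ n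
      ≡⟨ cong (ℚ._* κ n) (ι-∑ (digitVecs b n) _) ⟨
    ι (∑ (digitVecs b n) (λ as → ⟦ carryStep b i as Fin.≟ j ⟧)) ℚ.* κ n ∎

  P-rowSum : ∀ i → sumOver Ss (P n b i) ≡ 1ℚ
  P-rowSum i = begin
    sumOver Ss (P n b i)
      ≡⟨ sum-cong Ss (P-count i) ⟩
    sumOver Ss (λ j → ι (∑ Vs (λ as → ⟦ carryStep b i as Fin.≟ j ⟧)) ℚ.* κ n)
      ≡⟨ sum-*ʳ Ss (κ n) (λ j → ι (∑ Vs (λ as → ⟦ carryStep b i as Fin.≟ j ⟧))) ⟩
    sumOver Ss (λ j → ι (∑ Vs (λ as → ⟦ carryStep b i as Fin.≟ j ⟧))) ℚ.* κ n
      ≡⟨ cong (ℚ._* κ n) (ι-∑ Ss _) ⟨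
    ι (∑ Ss (λ j → ∑ Vs (λ as → ⟦ carryStep b i as Fin.≟ j ⟧))) ℚ.* κ n
      ≡⟨ cong (λ m → ι m ℚ.* κ n) (trans (Sumℕ.∑-swap Ss Vs _)
           (Sumℕ.∑-cong Vs (λ as → Sumℕ.∑-pick-1 (fins (suc n)) (carryStep b i as)))) ⟩
    ι (∑ Vs (λ _ → 1)) ℚ.* κ n
      ≡⟨ cong (λ m → ι m ℚ.* κ n) (digitVecs-count b n) ⟩
    ι (N ^ n) ℚ.* κ n
      ≡⟨ κ-unit n ⟩
    1ℚ ∎
    where Vs = digitVecs b n

  Q-weight : ∀ (μ : SignedPerm n) → Q b μ ≡ ι (weight (μ ⁻¹)) ℚ.* κ n
  Q-weight μ = trans (ratio (weight (μ ⁻¹)) (N ^ n) {{N^n≢0}}) (cong (ι (weight (μ ⁻¹)) ℚ.*_) (begin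
    (ℤ.+ 1 ℚ./ N ^ n) {{N^n≢0}}                            ≡⟨ ℚ.*-identityʳ _ ⟨
    (ℤ.+ 1 ℚ./ N ^ n) {{N^n≢0}} ℚ.* 1ℚ
      ≡⟨ cong ((ℤ.+ 1 ℚ./ N ^ n) {{N^n≢0}} ℚ.*_) (κ-unit n) ⟨
    (ℤ.+ 1 ℚ./ N ^ n) {{N^n≢0}} ℚ.* (ι (N ^ n) ℚ.* κ n)
      ≡⟨ ℚ.*-assoc ((ℤ.+ 1 ℚ./ N ^ n) {{N^n≢0}}) (ι (N ^ n)) (κ n) ⟨
    (ℤ.+ 1 ℚ./ N ^ n) {{N^n≢0}} ℚ.* ι (N ^ n) ℚ.* κ n
      ≡⟨ cong (ℚ._* κ n) (trans (ℚ.*-comm ((ℤ.+ 1 ℚ./ N ^ n) {{N^n≢0}}) (ι (N ^ n))) (unit-fraction (N ^ n) {{N^n≢0}})) ⟩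
    1ℚ ℚ.* κ n                                           ≡⟨ ℚ.*-identityˡ (κ n) ⟩
    κ n                                                ∎))
    where N^n≢0 = ℕ.m^n≢0 N n

  Q-cong : ∀ (σ τ : SignedPerm n) → σ ≈ τ → Q b σ ≡ Q b τ
  Q-cong σ τ σ≈τ = trans (Q-weight σ) (trans (cong (λ j → ι ((n ℕ.+ b ℕ.∸ toℕ j) C n) ℚ.* κ n)
    (d-cong (σ ⁻¹) (τ ⁻¹) (⁻¹-cong σ τ σ≈τ))) (sym (Q-weight τ)))

  Q-total : sumOver Gs (Q b) ≡ 1ℚ
  Q-total = begin
    sumOver Gs (Q b)                                ≡⟨ sum-cong Gs Q-weight ⟩
    sumOver Gs (λ μ → ι (weight (μ ⁻¹)) ℚ.* κ n)      ≡⟨ sum-*ʳ Gs (κ n) (λ μ → ι (weight (μ ⁻¹))) ⟩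
    sumOver Gs (λ μ → ι (weight (μ ⁻¹))) ℚ.* κ n      ≡⟨ cong (ℚ._* κ n) (ι-∑ Gs _) ⟨
    ι (∑ Gs (λ μ → weight (μ ⁻¹))) ℚ.* κ n
      ≡⟨ cong (λ m → ι m ℚ.* κ n) (trans (∑-weight {k}) (digitVecs-count b n)) ⟩
    ι (N ^ n) ℚ.* κ n                                 ≡⟨ κ-unit n ⟩
    1ℚ                                              ∎

  δ : SignedPerm n → State n
  δ τ = d (τ ⁻¹)

  -- Note the reversed indices: this is the entry (δ τ′ , i) of P, not (i , δ τ′).
  ∑-Q-class : ∀ i τ′ → sumOver Gs (λ τ → ⟪ δ τ Fin.≟ i ⟫ ℚ.* Q b (τ ⁻¹ ∘ₛ τ′)) ≡ P n b (δ τ′) i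
  ∑-Q-class i τ′ = begin
    sumOver Gs (λ τ → ⟪ δ τ Fin.≟ i ⟫ ℚ.* Q b (τ ⁻¹ ∘ₛ τ′))
      -- The inverse of `τ ⁻¹ ∘ₛ τ′` and `τ′ ⁻¹ ∘ₛ τ` have the same underlying map by computation,
      -- so their weights agree definitionally.
      ≡⟨ sum-cong Gs (λ τ → trans (cong₂ ℚ._*_ (sym (ι-⟦⟧ (δ τ Fin.≟ i))) (Q-weight (τ ⁻¹ ∘ₛ τ′)))
           (trans (sym (ℚ.*-assoc (ι ⟦ δ τ Fin.≟ i ⟧) (ι (weight (τ′ ⁻¹ ∘ₛ τ))) (κ n)))
             (cong (ℚ._* κ n) (sym (ι-* ⟦ δ τ Fin.≟ i ⟧ (weight (τ′ ⁻¹ ∘ₛ τ))))))) ⟩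
    sumOver Gs (λ τ → ι (⟦ δ τ Fin.≟ i ⟧ ℕ.* weight (τ′ ⁻¹ ∘ₛ τ)) ℚ.* κ n)
      ≡⟨ sum-*ʳ Gs (κ n) (λ τ → ι (⟦ δ τ Fin.≟ i ⟧ ℕ.* weight (τ′ ⁻¹ ∘ₛ τ))) ⟩
    sumOver Gs (λ τ → ι (⟦ δ τ Fin.≟ i ⟧ ℕ.* weight (τ′ ⁻¹ ∘ₛ τ))) ℚ.* κ n
      ≡⟨ cong (ℚ._* κ n) (ι-∑ Gs _) ⟨
    ι (∑ Gs (λ τ → ⟦ δ τ Fin.≟ i ⟧ ℕ.* weight (τ′ ⁻¹ ∘ₛ τ))) ℚ.* κ n
      ≡⟨ cong (λ m → ι m ℚ.* κ n) (∑-weight-class (τ′ ⁻¹) i) ⟩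
    ι (∑ (digitVecs b n) (λ as → ⟦ carryStep b (δ τ′) as Fin.≟ i ⟧)) ℚ.* κ n
      ≡⟨ P-count (δ τ′) i ⟨
    P n b (δ τ′) i ∎

  eul : State n → ℚ
  eul j = ι (eulerianᴮ n j)

  class-size : ∀ j → sumOver Gs (λ τ → ⟪ δ τ Fin.≟ j ⟫) ≡ eul j
  class-size j = begin
    sumOver Gs (λ τ → ⟪ δ τ Fin.≟ j ⟫)
      ≡⟨ sum-reindex (signedPerms n) (signedPerms n) _⁻¹ _⁻¹ (λ σ τ eq x → sym (⁻¹-cong
            (σ ⁻¹) τ eq x)) (λ σ τ eq x → sym (⁻¹-cong (τ ⁻¹) σ eq x))
           (λ {σ} {τ} σ≈τ → cong (λ i → ⟪ i Fin.≟ j ⟫) (d-cong σ τ σ≈τ)) ⟩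
    sumOver Gs (λ σ → ⟪ d σ Fin.≟ j ⟫)
      ≡⟨ sum-cong Gs (λ σ → ι-⟦⟧ (d σ Fin.≟ j)) ⟨
    sumOver Gs (λ σ → ι ⟦ d σ Fin.≟ j ⟧)
      ≡⟨ ι-∑ Gs _ ⟨
    ι (∑ Gs (λ σ → ⟦ d σ Fin.≟ j ⟧))
      ≡⟨ cong ι (eulerianᴮ-∑ n j) ⟨
    eul j ∎

  sum-by-class : ∀ (f : State n → ℚ) → sumOver Gs (f ∘ δ) ≡ sumOver Ss (λ j → eul j ℚ.* f j)
  sum-by-class f = begin
    sumOver Gs (f ∘ δ)
      ≡⟨ sum-cong Gs (λ τ → sum-pick (fins (suc n)) (cong f) (δ τ)) ⟨
    sumOver Gs (λ τ → sumOver Ss (λ j → ⟪ δ τ Fin.≟ j ⟫ ℚ.* f j))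
      ≡⟨ sum-swap Gs Ss (λ τ j → ⟪ δ τ Fin.≟ j ⟫ ℚ.* f j) ⟩
    sumOver Ss (λ j → sumOver Gs (λ τ → ⟪ δ τ Fin.≟ j ⟫ ℚ.* f j))
      ≡⟨ sum-cong Ss (λ j → trans (sum-*ʳ Gs (f j) (λ τ → ⟪ δ τ Fin.≟ j ⟫)) (cong (ℚ._* f j) (class-size j))) ⟩
    sumOver Ss (λ j → eul j ℚ.* f j) ∎

  -- As a statement about measures: one shuffle takes the counting measure on class `i` to a measure
  -- with density `P n b (δ τ′) i`, which is constant on every class. The substitution is
  -- `τ′ = τ ∘ₛ μ`.
  sum-translates : ∀ i {f : SignedPerm n → ℚ} → (∀ {σ τ} → σ ≈ τ → f σ ≡ f τ) →
    sumOver Gs (λ τ → ⟪ δ τ Fin.≟ i ⟫ ℚ.* sumOver Gs (λ μ → Q b μ ℚ.* f (τ ∘ₛ μ))) ≡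
    sumOver Gs (λ τ′ → P n b (δ τ′) i ℚ.* f τ′)
  sum-translates i {f} f-resp = begin
    sumOver Gs (λ τ → ⟪ δ τ Fin.≟ i ⟫ ℚ.* sumOver Gs (λ μ → Q b μ ℚ.* f (τ ∘ₛ μ)))
      ≡⟨ sum-cong Gs (λ τ → cong (⟪ δ τ Fin.≟ i ⟫ ℚ.*_) (translate τ)) ⟩
    sumOver Gs (λ τ → ⟪ δ τ Fin.≟ i ⟫ ℚ.* sumOver Gs (λ τ′ → Q b (τ ⁻¹ ∘ₛ τ′) ℚ.* f τ′))
      ≡⟨ sum-cong Gs (λ τ → trans (sym (sum-*ˡ Gs ⟪ δ τ Fin.≟ i ⟫ (λ τ′ → Q b (τ ⁻¹ ∘ₛ τ′) ℚ.* f τ′)))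
           (sum-cong Gs (λ τ′ → sym (ℚ.*-assoc ⟪ δ τ Fin.≟ i ⟫ (Q b (τ ⁻¹ ∘ₛ τ′)) (f τ′))))) ⟩
    sumOver Gs (λ τ → sumOver Gs (λ τ′ → ⟪ δ τ Fin.≟ i ⟫ ℚ.* Q b (τ ⁻¹ ∘ₛ τ′) ℚ.* f τ′))
      ≡⟨ sum-swap Gs Gs (λ τ τ′ → ⟪ δ τ Fin.≟ i ⟫ ℚ.* Q b (τ ⁻¹ ∘ₛ τ′) ℚ.* f τ′) ⟩
    sumOver Gs (λ τ′ → sumOver Gs (λ τ → ⟪ δ τ Fin.≟ i ⟫ ℚ.* Q b (τ ⁻¹ ∘ₛ τ′) ℚ.* f τ′))
      ≡⟨ sum-cong Gs (λ τ′ → trans (sum-*ʳ Gs (f τ′) (λ τ → ⟪ δ τ Fin.≟ i ⟫ ℚ.* Q b (τ ⁻¹ ∘ₛ τ′)))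
            (cong (ℚ._* f τ′) (∑-Q-class i τ′))) ⟩
    sumOver Gs (λ τ′ → P n b (δ τ′) i ℚ.* f τ′) ∎
    where
    translate : ∀ τ → sumOver Gs (λ μ → Q b μ ℚ.* f (τ ∘ₛ μ)) ≡ sumOver Gs (λ τ′ → Q b (τ ⁻¹ ∘ₛ τ′) ℚ.* f τ′)
    translate τ = begin
      sumOver Gs (λ μ → Q b μ ℚ.* f (τ ∘ₛ μ))
        ≡⟨ sum-cong Gs (λ μ → cong (ℚ._* f (τ ∘ₛ μ)) (Q-cong μ (τ ⁻¹ ∘ₛ τ ∘ₛ μ) (λ x → sym
              (SignedPerm.strictlyInverseʳ τ (to μ x))))) ⟩
      sumOver Gs (λ μ → Q b (τ ⁻¹ ∘ₛ τ ∘ₛ μ) ℚ.* f (τ ∘ₛ μ))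
        ≡⟨ sum-reindex (signedPerms n) (signedPerms n) (τ ∘ₛ_) (τ ⁻¹ ∘ₛ_)
             (λ μ τ′ τμ≈τ′ x → trans (cong (from τ) (sym (τμ≈τ′ x))) (SignedPerm.strictlyInverseʳ τ (to μ x)))
             (λ μ τ′ eq x → trans (cong (to τ) (sym (eq x))) (SignedPerm.strictlyInverseˡ τ (to τ′ x)))
             (λ {σ} {σ′} eq → cong₂ ℚ._*_ (Q-cong (τ ⁻¹ ∘ₛ σ) (τ ⁻¹ ∘ₛ σ′) (cong (from τ) ∘ eq)) (f-resp eq)) ⟩
      sumOver Gs (λ τ′ → Q b (τ ⁻¹ ∘ₛ τ′) ℚ.* f τ′) ∎

  -- Stationarity for the carries chain comes from conservation of mass in the shuffle: this is
  -- `sum-translates` for the constant function 1, grouped by target class.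
  eul-invariant : ∀ i → sumOver Ss (λ j → eul j ℚ.* P n b j i) ≡ eul i
  eul-invariant i = begin
    sumOver Ss (λ j → eul j ℚ.* P n b j i)
      ≡⟨ sum-by-class (λ j → P n b j i) ⟨
    sumOver Gs (λ τ → P n b (δ τ) i)
      ≡⟨ sum-cong Gs (λ τ → ℚ.*-identityʳ (P n b (δ τ) i)) ⟨
    sumOver Gs (λ τ → P n b (δ τ) i ℚ.* 1ℚ)
      ≡⟨ sum-translates i {λ _ → 1ℚ} (λ _ → refl) ⟨
    sumOver Gs (λ τ → ⟪ δ τ Fin.≟ i ⟫ ℚ.* sumOver Gs (λ μ → Q b μ ℚ.* 1ℚ))
      ≡⟨ sum-cong Gs (λ τ → trans (cong (⟪ δ τ Fin.≟ i ⟫ ℚ.*_) (trans (sum-cong Gs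
            (λ μ → ℚ.*-identityʳ (Q b μ))) Q-total)) (ℚ.*-identityʳ ⟪ δ τ Fin.≟ i ⟫)) ⟩
    sumOver Gs (λ τ → ⟪ δ τ Fin.≟ i ⟫)
      ≡⟨ class-size i ⟩
    eul i ∎

-- Cancellation, guards and signs in the rationals

÷-cancelʳ : ∀ p q .{{_ : NonZero q}} → p ℚ.* q ℚ.÷ q ≡ p
÷-cancelʳ p q = begin
  p ℚ.* q ℚ.* ℚ.1/ q    ≡⟨ ℚ.*-assoc p q (ℚ.1/ q) ⟩
  p ℚ.* (q ℚ.* ℚ.1/ q)  ≡⟨ cong (p ℚ.*_) (ℚ.*-inverseʳ q) ⟩
  p ℚ.* 1ℚ          ≡⟨ ℚ.*-identityʳ p ⟩
  p               ∎

*-÷-cancel : ∀ p q .{{_ : NonZero q}} → q ℚ.* (p ℚ.÷ q) ≡ p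
*-÷-cancel p q = begin
  q ℚ.* (p ℚ.* ℚ.1/ q)  ≡⟨ *-rotate q p (ℚ.1/ q) ⟩
  p ℚ.* (q ℚ.* ℚ.1/ q)  ≡⟨ cong (p ℚ.*_) (ℚ.*-inverseʳ q) ⟩
  p ℚ.* 1ℚ          ≡⟨ ℚ.*-identityʳ p ⟩
  p               ∎

guard-idem : ∀ {X : Set} (p : Dec X) r → ⟪ p ⟫ ℚ.* r ≡ ⟪ p ⟫ ℚ.* (⟪ p ⟫ ℚ.* r)
guard-idem p r = ⟪⟫-guard p (λ x → sym (trans (cong (ℚ._* r) (⟪⟫-yes p x)) (ℚ.*-identityˡ r)))

sum-nonNeg : ∀ {A : Set} (xs : List A) {f : A → ℚ} → (∀ x → 0ℚ ℚ.≤ f x) → 0ℚ ℚ.≤ sumOver xs f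
sum-nonNeg []       f≥0 = ℚ.≤-refl
sum-nonNeg (x ∷ xs) f≥0 = ℚ.+-mono-≤ (f≥0 x) (sum-nonNeg xs f≥0)

*-nonNeg : ∀ {p q} → 0ℚ ℚ.≤ p → 0ℚ ℚ.≤ q → 0ℚ ℚ.≤ p ℚ.* q
*-nonNeg {p} {q} p≥0 q≥0 = ℚ.nonNegative⁻¹ (p ℚ.* q)
  {{ℚ.nonNeg*nonNeg⇒nonNeg p {{ℚ.nonNegative p≥0}} q {{ℚ.nonNegative q≥0}}}}

-- The reversed chain

module Reversal (k b : ℕ) where

  open Probabilities k b

  instance
    order≢0 : ℕ.NonZero (2 ^ n ℕ.* n !)
    order≢0 = ℕ.m*n≢0 _ _ {{ℕ.m^n≢0 2 n}} {{n ℕ.!≢0}}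

  z : ℚ
  z = (ℤ.+ 1 ℚ./ (2 ^ n ℕ.* n !))

  M : ℚ
  M = ι (2 ^ n ℕ.* n !)

  M*z : M ℚ.* z ≡ 1ℚ
  M*z = unit-fraction (2 ^ n ℕ.* n !)

  π-eul : ∀ j → π n j ≡ eul j ℚ.* z
  π-eul j = ratio (eulerianᴮ n j) (2 ^ n ℕ.* n !)

  eul-π : ∀ j → eul j ≡ M ℚ.* π n j
  eul-π j = begin
    eul j              ≡⟨ ℚ.*-identityʳ (eul j) ⟨
    eul j ℚ.* 1ℚ         ≡⟨ cong (eul j ℚ.*_) M*z ⟨
    eul j ℚ.* (M ℚ.* z)    ≡⟨ *-rotate (eul j) M z ⟩
    M ℚ.* (eul j ℚ.* z)    ≡⟨ cong (M ℚ.*_) (π-eul j) ⟨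
    M ℚ.* π n j          ∎

  π-positive : ∀ j → Positive (π n j)
  π-positive j = ℚ.normalize-pos (eulerianᴮ n j) (2 ^ n ℕ.* n !)
    {{order≢0}} {{ℕ.>-nonZero (eulerianᴮ-positive k j)}}

  π≢0 : ∀ j → NonZero (π n j)
  π≢0 j = ℚ.pos⇒nonZero (π n j) {{π-positive j}}

  π-nonNeg : ∀ j → 0ℚ ℚ.≤ π n j
  π-nonNeg j = ℚ.<⇒≤ (ℚ.positive⁻¹ (π n j) {{π-positive j}})

  π-total : sumOver Ss (π n) ≡ 1ℚ
  π-total = begin
    sumOver Ss (π n)                    ≡⟨ sum-cong Ss π-eul ⟩
    sumOver Ss (λ j → eul j ℚ.* z)        ≡⟨ sum-*ʳ Ss z eul ⟩
    sumOver Ss eul ℚ.* z                  ≡⟨ cong (ℚ._* z) (ι-∑ Ss (eulerianᴮ n)) ⟨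
    ι (∑ Ss (eulerianᴮ n)) ℚ.* z          ≡⟨ cong (λ m → ι m ℚ.* z) (∑-eulerianᴮ n) ⟩
    M ℚ.* z                               ≡⟨ M*z ⟩
    1ℚ                                  ∎

  P-nonNeg : ∀ i j → 0ℚ ℚ.≤ P n b i j
  P-nonNeg i j = sum-nonNeg (List.filter (λ as → carryStep b i as Fin.≟ j) (digitVecs b n)) mass-nonNeg
    where
    mass-nonNeg : ∀ {r} (as : Vec (Digit b) r) → 0ℚ ℚ.≤ mass (iid (uniformDigit b) r) as
    mass-nonNeg []       = ℚ.nonNegative⁻¹ 1ℚ
    mass-nonNeg (a ∷ as) = *-nonNeg (ℚ.nonNegative⁻¹ (ℤ.+ 1 ℚ./ N) {{ℚ.normalize-nonNeg 1 N}}) (mass-nonNeg as)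

  K : Matrix (suc n)
  K = timeReversal (π n) π≢0 (P n b)

  detailed-balance : ∀ i j → π n i ℚ.* K i j ≡ π n j ℚ.* P n b j i
  detailed-balance i j = *-÷-cancel (π n j ℚ.* P n b j i) (π n i) {{π≢0 i}}

  eul-balance : ∀ i j → eul i ℚ.* K i j ≡ eul j ℚ.* P n b j i
  eul-balance i j = begin
    eul i ℚ.* K i j              ≡⟨ cong (ℚ._* K i j) (eul-π i) ⟩
    M ℚ.* π n i ℚ.* K i j          ≡⟨ ℚ.*-assoc M (π n i) (K i j) ⟩
    M ℚ.* (π n i ℚ.* K i j)        ≡⟨ cong (M ℚ.*_) (detailed-balance i j) ⟩
    M ℚ.* (π n j ℚ.* P n b j i)    ≡⟨ ℚ.*-assoc M (π n j) (P n b j i) ⟨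
    M ℚ.* π n j ℚ.* P n b j i      ≡⟨ cong (ℚ._* P n b j i) (eul-π j) ⟨
    eul j ℚ.* P n b j i          ∎

  π-invariant-P : ∀ i → sumOver Ss (λ j → π n j ℚ.* P n b j i) ≡ π n i
  π-invariant-P i = begin
    sumOver Ss (λ j → π n j ℚ.* P n b j i)
      ≡⟨ sum-cong Ss (λ j → trans (cong (ℚ._* P n b j i) (trans (π-eul j) (ℚ.*-comm (eul j) z)))
            (ℚ.*-assoc z (eul j) (P n b j i))) ⟩
    sumOver Ss (λ j → z ℚ.* (eul j ℚ.* P n b j i))  ≡⟨ sum-*ˡ Ss z (λ j → eul j ℚ.* P n b j i) ⟩
    z ℚ.* sumOver Ss (λ j → eul j ℚ.* P n b j i)    ≡⟨ cong (z ℚ.*_) (eul-invariant i) ⟩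
    z ℚ.* eul i                                   ≡⟨ trans (ℚ.*-comm z (eul i)) (sym (π-eul i)) ⟩
    π n i                                       ∎

  -- Reversal exchanges the two sums: row sums of `K` amount to invariance of `π n` under `P n b`,
  -- and in `K-stationary` invariance under `K` amounts to row sums of `P n b`.
  K-stochastic : IsStochastic K
  K-stochastic = record
    { nonNegative = λ i j → *-nonNeg (*-nonNeg (π-nonNeg j) (P-nonNeg j i)) (1/π-nonNeg i)
    ; rowSum = λ i → begin
        sumOver Ss (K i)
          ≡⟨ sum-*ʳ Ss ((ℚ.1/ π n i) {{π≢0 i}}) (λ j → π n j ℚ.* P n b j i) ⟩
        sumOver Ss (λ j → π n j ℚ.* P n b j i) ℚ.* (ℚ.1/ π n i) {{π≢0 i}}
          ≡⟨ cong (ℚ._* (ℚ.1/ π n i) {{π≢0 i}}) (π-invariant-P i) ⟩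
        π n i ℚ.* (ℚ.1/ π n i) {{π≢0 i}}
          ≡⟨ ℚ.*-inverseʳ (π n i) {{π≢0 i}} ⟩
        1ℚ ∎
    }
    where
    1/π-nonNeg : ∀ i → 0ℚ ℚ.≤ (ℚ.1/ π n i) {{π≢0 i}}
    1/π-nonNeg i = ℚ.<⇒≤ (ℚ.positive⁻¹ ((ℚ.1/ π n i) {{π≢0 i}}) {{ℚ.1/pos⇒pos (π n i) {{π-positive i}}}})

  K-stationary : IsStationary (π n) K
  K-stationary = record
    { nonNegative = π-nonNeg
    ; total = π-total
    ; invariant = λ j → begin
        sumOver Ss (λ i → π n i ℚ.* K i j)        ≡⟨ sum-cong Ss (λ i → detailed-balance i j) ⟩
        sumOver Ss (λ i → π n j ℚ.* P n b j i)    ≡⟨ sum-*ˡ Ss (π n j) (P n b j) ⟩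
        π n j ℚ.* sumOver Ss (P n b j)            ≡⟨ cong (π n j ℚ.*_) (P-rowSum j) ⟩
        π n j ℚ.* 1ℚ                              ≡⟨ ℚ.*-identityʳ (π n j) ⟩
        π n j                                   ∎
    }

  reversal-involutive : ∀ i j → timeReversal (π n) π≢0 K i j ≡ P n b i j
  reversal-involutive i j = begin
    (π n j ℚ.* K j i ℚ.÷ π n i) {{π≢0 i}}
      ≡⟨ cong (λ p → (p ℚ.÷ π n i) {{π≢0 i}}) (trans (detailed-balance j i) (ℚ.*-comm (π n i) (P n b i j))) ⟩
    (P n b i j ℚ.* π n i ℚ.÷ π n i) {{π≢0 i}}    ≡⟨ ÷-cancelʳ (P n b i j) (π n i) {{π≢0 i}} ⟩
    P n b i j                                ∎

  -- An arbitrary start allows first-step analysis, since after the shuffle `μ` the process restarts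
  -- at `τ ∘ₛ μ`. At `idₛ` it is `descentProcess` by definition.
  processFrom : SignedPerm n → ∀ {r} → Vec (SignedPerm n) r → State n
  processFrom τ μs = δ (Vec.foldl′ _∘ₛ_ τ μs)

  past? : ∀ τ {r} (ω : Vec (SignedPerm n) (suc r)) js → Dec (Vec.init (path (processFrom τ) ω) ≡ js)
  past? τ ω js = Vec.≡-dec Fin._≟_ (Vec.init (path (processFrom τ) ω)) js

  -- The probability that the carries chain runs through the history backwards, given its last state
  -- as start; it will cancel from the conditional probability.
  pathFactor : ∀ {r} → Vec (State n) (suc r) → ℚ
  pathFactor (i ∷ [])             = 1ℚ
  pathFactor (i ∷ js@(i′ ∷ _))    = P n b i′ i ℚ.* pathFactor js

  ∘ₛ-congˡ : ∀ (σ τ μ : SignedPerm n) → σ ≈ τ → σ ∘ₛ μ ≈ τ ∘ₛ μ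
  ∘ₛ-congˡ σ τ μ σ≈τ x = σ≈τ (to μ x)

  δ-cong : ∀ (σ τ : SignedPerm n) → σ ≈ τ → δ σ ≡ δ τ
  δ-cong σ τ σ≈τ = d-cong (σ ⁻¹) (τ ⁻¹) (⁻¹-cong σ τ σ≈τ)

  module _ (g : State n → ℚ) where

    -- The expectation of g at the next state, on the event that the process started at τ
    -- has the given history.
    weightFrom : SignedPerm n → ∀ {r} → Vec (State n) (suc r) → ℚ
    weightFrom τ (i ∷ [])         = ⟪ δ τ Fin.≟ i ⟫ ℚ.* sumOver Gs (λ μ → Q b μ ℚ.* g (δ (τ ∘ₛ μ)))
    weightFrom τ (i ∷ js@(_ ∷ _)) = ⟪ δ τ Fin.≟ i ⟫ ℚ.* sumOver Gs (λ μ → Q b μ ℚ.* weightFrom (τ ∘ₛ μ) js)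

    weightFrom-cong : ∀ σ τ → σ ≈ τ → ∀ {r} (js : Vec (State n) (suc r)) → weightFrom σ js ≡ weightFrom τ js
    weightFrom-cong σ τ σ≈τ (i ∷ [])         = cong₂ ℚ._*_ (cong (λ j → ⟪ j Fin.≟ i ⟫) (δ-cong σ τ σ≈τ))
      (sum-cong Gs (λ μ → cong (λ j → Q b μ ℚ.* g j) (δ-cong (σ ∘ₛ μ) (τ ∘ₛ μ) (∘ₛ-congˡ σ τ μ σ≈τ))))
    weightFrom-cong σ τ σ≈τ (i ∷ js@(_ ∷ _)) = cong₂ ℚ._*_ (cong (λ j → ⟪ j Fin.≟ i ⟫) (δ-cong σ τ σ≈τ))
      (sum-cong Gs (λ μ → cong (Q b μ ℚ.*_) (weightFrom-cong (σ ∘ₛ μ) (τ ∘ₛ μ) (∘ₛ-congˡ σ τ μ σ≈τ) js)))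

    weightFrom-head : ∀ τ {r} (js : Vec (State n) (suc r)) →
      weightFrom τ js ≡ ⟪ δ τ Fin.≟ Vec.head js ⟫ ℚ.* weightFrom τ js
    weightFrom-head τ (i ∷ [])    = guard-idem (δ τ Fin.≟ i) _
    weightFrom-head τ (i ∷ _ ∷ _) = guard-idem (δ τ Fin.≟ i) _

    -- For `g` constantly 1 these terms add up to the probability of the history, and for the
    -- indicator of `j` to that of the history followed by `j`.
    pathTerm : SignedPerm n → ∀ {r} → Vec (State n) (suc r) → Vec (SignedPerm n) (suc r) → ℚ
    pathTerm τ js ω = ⟪ past? τ ω js ⟫ ℚ.* (g (processFrom τ ω) ℚ.* mass (iid (shuffle n b) _) ω)

    sum-paths : ∀ τ {r} (js : Vec (State n) (suc r)) →
      sumOver (allVecs Gs (suc r)) (pathTerm τ js) ≡ weightFrom τ js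
    sum-paths τ (i ∷ []) = begin
      sumOver (allVecs Gs 1) (pathTerm τ (i ∷ []))
        ≡⟨ sum-cartesianProductWith _∷_ Gs ([] ∷ []) (pathTerm τ (i ∷ [])) ⟩
      sumOver Gs (λ μ → ⟪ past? τ (μ ∷ []) (i ∷ []) ⟫ ℚ.* (g (δ (τ ∘ₛ μ)) ℚ.* (Q b μ ℚ.* 1ℚ)) ℚ.+ 0ℚ)
        ≡⟨ sum-cong Gs (λ μ → trans (ℚ.+-identityʳ _) (cong₂ ℚ._*_
             (trans (⟪⟫-× (δ τ Fin.≟ i) (Vec.≡-dec (Fin._≟_ {suc n}) [] [])) (ℚ.*-identityʳ ⟪ δ τ Fin.≟ i ⟫))
             (trans (cong (g (δ (τ ∘ₛ μ)) ℚ.*_) (ℚ.*-identityʳ (Q b μ))) (ℚ.*-comm (g (δ (τ ∘ₛ μ))) (Q b μ))))) ⟩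
      sumOver Gs (λ μ → ⟪ δ τ Fin.≟ i ⟫ ℚ.* (Q b μ ℚ.* g (δ (τ ∘ₛ μ))))
        ≡⟨ sum-*ˡ Gs ⟪ δ τ Fin.≟ i ⟫ (λ μ → Q b μ ℚ.* g (δ (τ ∘ₛ μ))) ⟩
      weightFrom τ (i ∷ []) ∎
    sum-paths τ {suc r} (i ∷ js@(_ ∷ _)) = begin
      sumOver (allVecs Gs (suc (suc r))) (pathTerm τ (i ∷ js))
        ≡⟨ sum-cartesianProductWith _∷_ Gs (allVecs Gs (suc r)) (pathTerm τ (i ∷ js)) ⟩
      sumOver Gs (λ μ → sumOver (allVecs Gs (suc r)) (λ ω →
        ⟪ past? τ (μ ∷ ω) (i ∷ js) ⟫ ℚ.* (g (processFrom (τ ∘ₛ μ) ω) ℚ.* (Q b μ ℚ.* m ω))))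
        ≡⟨ sum-cong Gs (λ μ → trans (sum-cong (allVecs Gs (suc r)) (step μ))
             (trans (sum-*ˡ (allVecs Gs (suc r)) ⟪ δ τ Fin.≟ i ⟫ _) (cong (⟪ δ τ Fin.≟ i ⟫ ℚ.*_)
               (trans (sum-*ˡ (allVecs Gs (suc r)) (Q b μ) _) (cong (Q b μ ℚ.*_) (sum-paths (τ ∘ₛ μ) js)))))) ⟩
      sumOver Gs (λ μ → ⟪ δ τ Fin.≟ i ⟫ ℚ.* (Q b μ ℚ.* weightFrom (τ ∘ₛ μ) js))
        ≡⟨ sum-*ˡ Gs ⟪ δ τ Fin.≟ i ⟫ (λ μ → Q b μ ℚ.* weightFrom (τ ∘ₛ μ) js) ⟩
      weightFrom τ (i ∷ js) ∎
      where
      m : Vec (SignedPerm n) (suc r) → ℚ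
      m = mass (iid (shuffle n b) (suc r))
      step : ∀ μ ω → ⟪ past? τ (μ ∷ ω) (i ∷ js) ⟫ ℚ.* (g (processFrom (τ ∘ₛ μ) ω) ℚ.* (Q b μ ℚ.* m ω)) ≡
                     ⟪ δ τ Fin.≟ i ⟫ ℚ.* (Q b μ ℚ.* (⟪ past? (τ ∘ₛ μ) ω js ⟫ ℚ.* (g (processFrom (τ ∘ₛ μ) ω) ℚ.* m ω)))
      step μ ω@(_ ∷ _) = begin
        ⟪ past? τ (μ ∷ ω) (i ∷ js) ⟫ ℚ.* (x ℚ.* (Q b μ ℚ.* m ω))
          ≡⟨ cong₂ ℚ._*_ (⟪⟫-× (δ τ Fin.≟ i) (past? (τ ∘ₛ μ) ω js)) (*-rotate x (Q b μ) (m ω)) ⟩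
        ⟪ δ τ Fin.≟ i ⟫ ℚ.* p ℚ.* (Q b μ ℚ.* (x ℚ.* m ω))
          ≡⟨ ℚ.*-assoc ⟪ δ τ Fin.≟ i ⟫ p _ ⟩
        ⟪ δ τ Fin.≟ i ⟫ ℚ.* (p ℚ.* (Q b μ ℚ.* (x ℚ.* m ω)))
          ≡⟨ cong (⟪ δ τ Fin.≟ i ⟫ ℚ.*_) (*-rotate p (Q b μ) (x ℚ.* m ω)) ⟩
        ⟪ δ τ Fin.≟ i ⟫ ℚ.* (Q b μ ℚ.* (p ℚ.* (x ℚ.* m ω))) ∎
        where
        x = g (processFrom (τ ∘ₛ μ) ω)
        p = ⟪ past? (τ ∘ₛ μ) ω js ⟫

    -- The total of `g` after one shuffle from the counting measure on class `i`, grouped by target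
    -- class.
    endFactor : State n → ℚ
    endFactor i = sumOver Ss (λ j → eul j ℚ.* (P n b j i ℚ.* g j))

    -- The first shuffle leaves the density `P n b (δ τ) i`. The remaining weight vanishes off the
    -- class `i′` of the next state, so the density is the constant `P n b i′ i` there and factors
    -- out.
    sum-weightFrom : ∀ {r} (js : Vec (State n) (suc r)) →
      sumOver Gs (λ τ → weightFrom τ js) ≡ pathFactor js ℚ.* endFactor (Vec.last js)
    sum-weightFrom (i ∷ []) = begin
      sumOver Gs (λ τ → weightFrom τ (i ∷ []))
        ≡⟨ sum-translates i {g ∘ δ} (λ {σ} {τ} eq → cong g (δ-cong σ τ eq)) ⟩
      sumOver Gs (λ τ → P n b (δ τ) i ℚ.* g (δ τ))
        ≡⟨ sum-by-class (λ j → P n b j i ℚ.* g j) ⟩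
      endFactor i
        ≡⟨ ℚ.*-identityˡ (endFactor i) ⟨
      1ℚ ℚ.* endFactor i ∎
    sum-weightFrom (i ∷ js@(i′ ∷ _)) = begin
      sumOver Gs (λ τ → weightFrom τ (i ∷ js))
        ≡⟨ sum-translates i {λ τ → weightFrom τ js} (λ {σ} {τ} eq → weightFrom-cong σ τ eq js) ⟩
      sumOver Gs (λ τ → P n b (δ τ) i ℚ.* weightFrom τ js)
        ≡⟨ sum-cong Gs at-head ⟩
      sumOver Gs (λ τ → P n b i′ i ℚ.* weightFrom τ js)
        ≡⟨ sum-*ˡ Gs (P n b i′ i) (λ τ → weightFrom τ js) ⟩
      P n b i′ i ℚ.* sumOver Gs (λ τ → weightFrom τ js)
        ≡⟨ cong (P n b i′ i ℚ.*_) (sum-weightFrom js) ⟩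
      P n b i′ i ℚ.* (pathFactor js ℚ.* endFactor (Vec.last js))
        ≡⟨ ℚ.*-assoc (P n b i′ i) (pathFactor js) (endFactor (Vec.last js)) ⟨
      P n b i′ i ℚ.* pathFactor js ℚ.* endFactor (Vec.last js) ∎
      where
      at-head : ∀ τ → P n b (δ τ) i ℚ.* weightFrom τ js ≡ P n b i′ i ℚ.* weightFrom τ js
      at-head τ = begin
        P n b (δ τ) i ℚ.* weightFrom τ js
          ≡⟨ cong (P n b (δ τ) i ℚ.*_) (weightFrom-head τ js) ⟩
        P n b (δ τ) i ℚ.* (⟪ δ τ Fin.≟ i′ ⟫ ℚ.* weightFrom τ js)
          ≡⟨ *-rotate (P n b (δ τ) i) ⟪ δ τ Fin.≟ i′ ⟫ (weightFrom τ js) ⟩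
        ⟪ δ τ Fin.≟ i′ ⟫ ℚ.* (P n b (δ τ) i ℚ.* weightFrom τ js)
          ≡⟨ ⟪⟫-guard (δ τ Fin.≟ i′) (λ eq → cong (λ l → P n b l i ℚ.* weightFrom τ js) eq) ⟩
        ⟪ δ τ Fin.≟ i′ ⟫ ℚ.* (P n b i′ i ℚ.* weightFrom τ js)
          ≡⟨ *-rotate ⟪ δ τ Fin.≟ i′ ⟫ (P n b i′ i) (weightFrom τ js) ⟩
        P n b i′ i ℚ.* (⟪ δ τ Fin.≟ i′ ⟫ ℚ.* weightFrom τ js)
          ≡⟨ cong (P n b i′ i ℚ.*_) (weightFrom-head τ js) ⟨
        P n b i′ i ℚ.* weightFrom τ js ∎

    -- The sum over all starting points picks out id, the only element with δ = 0.
    weightFrom-id : ∀ {r} (js : Vec (State n) (suc r)) →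
      weightFrom idₛ js ≡ ⟪ zero Fin.≟ Vec.head js ⟫ ℚ.* (pathFactor js ℚ.* endFactor (Vec.last js))
    weightFrom-id js = begin
      weightFrom idₛ js
        ≡⟨ weightFrom-head idₛ js ⟩
      ⟪ δ idₛ Fin.≟ Vec.head js ⟫ ℚ.* weightFrom idₛ js
        ≡⟨ cong (λ i → ⟪ i Fin.≟ Vec.head js ⟫ ℚ.* weightFrom idₛ js) (d-id {n}) ⟩
      ⟪ zero Fin.≟ Vec.head js ⟫ ℚ.* weightFrom idₛ js
        -- Only for histories starting at 0 may the indicator of `idₛ` be traded for that of the
        -- starting class; for all others both sides are killed by the guard.
        ≡⟨ ⟪⟫-guard (zero Fin.≟ Vec.head js) (λ eq → begin
             weightFrom idₛ js
               ≡⟨ sum-pick (signedPerms n) (λ {σ} {τ} σ≈τ → weightFrom-cong σ τ σ≈τ js) idₛ ⟨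
             sumOver Gs (λ τ → ⟪ idₛ ≈? τ ⟫ ℚ.* weightFrom τ js)
               ≡⟨ sum-cong Gs (λ τ → trans (cong (ℚ._* weightFrom τ js) (⟪⟫-⇔ (idₛ ≈? τ) (δ τ Fin.≟ Vec.head js)
                    (λ id≈τ → trans (δ-cong τ idₛ (sym ∘ id≈τ)) (trans (d-id {n}) eq))
                    (λ δτ≡ → ⁻¹-cong idₛ (τ ⁻¹) (sym ∘ d≡0⇒id (τ ⁻¹) (trans δτ≡ (sym eq))))))
                    (sym (weightFrom-head τ js))) ⟩
             sumOver Gs (λ τ → weightFrom τ js)
               ≡⟨ sum-weightFrom js ⟩
             pathFactor js ℚ.* endFactor (Vec.last js) ∎) ⟩
      ⟪ zero Fin.≟ Vec.head js ⟫ ℚ.* (pathFactor js ℚ.* endFactor (Vec.last js)) ∎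

  endFactor-1 : ∀ i → endFactor (λ _ → 1ℚ) i ≡ eul i
  endFactor-1 i = trans (sum-cong Ss (λ j → cong (eul j ℚ.*_) (ℚ.*-identityʳ (P n b j i)))) (eul-invariant i)

  -- The reversal appears here: the sum picks `eul j` times `P n b j i`, and detailed balance
  -- rewrites it. Dividing by `endFactor-1` leaves the entry of `K`.
  endFactor-at : ∀ i j → endFactor (λ l → ⟪ l Fin.≟ j ⟫) i ≡ K i j ℚ.* eul i
  endFactor-at i j = begin
    sumOver Ss (λ l → eul l ℚ.* (P n b l i ℚ.* ⟪ l Fin.≟ j ⟫))
      ≡⟨ sum-cong Ss (λ l → trans (sym (ℚ.*-assoc (eul l) (P n b l i) ⟪ l Fin.≟ j ⟫))
           (trans (ℚ.*-comm (eul l ℚ.* P n b l i) ⟪ l Fin.≟ j ⟫) (cong (ℚ._*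
                 (eul l ℚ.* P n b l i)) (⟪⟫-⇔ (l Fin.≟ j) (j Fin.≟ l) sym sym)))) ⟩
    sumOver Ss (λ l → ⟪ j Fin.≟ l ⟫ ℚ.* (eul l ℚ.* P n b l i))
      ≡⟨ sum-pick (fins (suc n)) (cong (λ l → eul l ℚ.* P n b l i)) j ⟩
    eul j ℚ.* P n b j i
      ≡⟨ eul-balance i j ⟨
    eul i ℚ.* K i j
      ≡⟨ ℚ.*-comm (eul i) (K i j) ⟩
    K i j ℚ.* eul i ∎

  -- The two sums share the start indicator and `pathFactor`, and differ only in their `endFactor`.
  -- The multiplicative form also covers histories of probability zero and leaves the division to
  -- `transition`.
  K-paths : ∀ {r} (js : Vec (State n) (suc r)) (j : State n) →
    sumOver (allVecs Gs (suc r)) (pathTerm (λ i → ⟪ i Fin.≟ j ⟫) idₛ js) ≡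
    K (Vec.last js) j ℚ.* sumOver (allVecs Gs (suc r)) (pathTerm (λ _ → 1ℚ) idₛ js)
  K-paths {r} js j = begin
    sumOver (allVecs Gs (suc r)) (pathTerm at-j idₛ js)
      ≡⟨ trans (sum-paths at-j idₛ js) (weightFrom-id at-j js) ⟩
    s ℚ.* (p ℚ.* endFactor at-j l)
      ≡⟨ cong (λ q → s ℚ.* (p ℚ.* q)) (endFactor-at l j) ⟩
    s ℚ.* (p ℚ.* (K l j ℚ.* eul l))
      ≡⟨ cong (s ℚ.*_) (*-rotate p (K l j) (eul l)) ⟩
    s ℚ.* (K l j ℚ.* (p ℚ.* eul l))
      ≡⟨ *-rotate s (K l j) (p ℚ.* eul l) ⟩
    K l j ℚ.* (s ℚ.* (p ℚ.* eul l))
      ≡⟨ cong (λ q → K l j ℚ.* (s ℚ.* (p ℚ.* q))) (endFactor-1 l) ⟨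
    K l j ℚ.* (s ℚ.* (p ℚ.* endFactor (λ _ → 1ℚ) l))
      ≡⟨ cong (K l j ℚ.*_) (trans (sum-paths (λ _ → 1ℚ) idₛ js) (weightFrom-id (λ _ → 1ℚ) js)) ⟨
    K l j ℚ.* sumOver (allVecs Gs (suc r)) (pathTerm (λ _ → 1ℚ) idₛ js) ∎
    where
    at-j : State n → ℚ
    at-j i = ⟪ i Fin.≟ j ⟫
    l = Vec.last js
    s = ⟪ zero Fin.≟ Vec.head js ⟫
    p = pathFactor js

  isMarkovChain : IsMarkovChain (shuffle n b) descentProcess K
  isMarkovChain = record { stochastic = K-stochastic ; transition = transition }
    where
    transition : ∀ {r} (js : Vec (State n) (suc r)) (j : State n) →
      let future? = λ ω → descentProcess ω Fin.≟ j
          past?   = λ ω → Vec.≡-dec Fin._≟_ (Vec.init (path descentProcess ω)) js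
      in (pos : NonZero (Pr (iid (shuffle n b) (suc r)) past?)) →
         condPr (iid (shuffle n b) (suc r)) future? past? {{pos}} ≡ K (Vec.last js) j
    transition {r} js j pos = trans (cong (λ p → (p ℚ.÷ Pr 𝒫 before?) {{pos}}) joint)
      (÷-cancelʳ (K (Vec.last js) j) (Pr 𝒫 before?) {{pos}})
      where
      𝒫 = iid (shuffle n b) (suc r)
      Ωs = allVecs Gs (suc r)
      before? : Decidable (λ ω → Vec.init (path descentProcess ω) ≡ js)
      before? ω = Vec.≡-dec Fin._≟_ (Vec.init (path descentProcess ω)) js
      after? : Decidable (λ ω → descentProcess {n} {suc r} ω ≡ j)
      after? ω = descentProcess ω Fin.≟ j
      before : Pr 𝒫 before? ≡ sumOver Ωs (pathTerm (λ _ → 1ℚ) idₛ js)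
      before = trans (sum-filter before? Ωs (mass 𝒫))
        (sum-cong Ωs (λ ω → cong (⟪ before? ω ⟫ ℚ.*_) (sym (ℚ.*-identityˡ (mass 𝒫 ω)))))
      joint : Pr 𝒫 (after? ∩? before?) ≡ K (Vec.last js) j ℚ.* Pr 𝒫 before?
      joint = begin
        Pr 𝒫 (after? ∩? before?)
          ≡⟨ sum-filter (after? ∩? before?) Ωs (mass 𝒫) ⟩
        sumOver Ωs (λ ω → ⟪ after? ω ×-dec before? ω ⟫ ℚ.* mass 𝒫 ω)
          ≡⟨ sum-cong Ωs (λ ω → trans (cong (ℚ._* mass 𝒫 ω) (trans (⟪⟫-× (after? ω) (before? ω))
                (ℚ.*-comm ⟪ after? ω ⟫ ⟪ before? ω ⟫)))
               (ℚ.*-assoc ⟪ before? ω ⟫ ⟪ after? ω ⟫ (mass 𝒫 ω))) ⟩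
        sumOver Ωs (pathTerm (λ i → ⟪ i Fin.≟ j ⟫) idₛ js)
          ≡⟨ K-paths js j ⟩
        K (Vec.last js) j ℚ.* sumOver Ωs (pathTerm (λ _ → 1ℚ) idₛ js)
          ≡⟨ cong (K (Vec.last js) j ℚ.*_) before ⟨
        K (Vec.last js) j ℚ.* Pr 𝒫 before? ∎

theorem4p3 : (n b : ℕ) → 1 ≤ n → 1 ≤ b →
    Σ[ K ∈ Matrix (suc n) ]
    ( IsMarkovChain (shuffle n b) descentProcess K
    × IsStationary (π n) K
    × Σ[ π≢0 ∈ (∀ i → NonZero (π n i)) ]
    ( (∀ i j → K i j ≡ timeReversal (π n) π≢0 (P n b) i j)
    × (∀ i j → timeReversal (π n) π≢0 K i j ≡ P n b i j) ) )
theorem4p3 (suc k) b _ _ =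
  K , isMarkovChain , K-stationary , π≢0 , (λ _ _ → refl) , reversal-involutive
  where open Reversal k b
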